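{- Let $v=q_1q_2\cdots q_s$ be the factorization of $v\ge2$ into powers of distinct primes, and let $k=\min\{q_i:1\le i\le s\}$. Let $t,d$ be positive integers with $q_i>t+1$ for all $i$ and $d+1\le v$. Then an optimum $(d,t)$-CDA$((d+1)v^t;k+t-1,v)$ exists.
   Context: Consecutive $t$-way interaction in an $N\times k$ array $A=(a_{ij})$ over a $v$-set $V$: $T=\{(i,x_i),\dots,(i+t-1,x_{i+t-1})\}$, $1\le i\le k-t+1$, $x_r\in V$; $\rho(A,T)=\{r: a_{r,j}=x_j\ \forall (j,x_j)\in T\}$, $\rho(A,\mathcal T)=\bigcup_{T\in\mathcal T}\rho(A,T)$. A $(d,t)$-CDA$(N;k,v)$ is an $N\times k$ array over $V$ in which every $t$ consecutive columns contain every $t$-tuple at least once, and such that for every set $\mathcal T$ of exactly $d$ distinct consecutive $t$-way interactions and every consecutive $t$-way interaction $T$: $\rho(A,T)\subseteq\rho(A,\mathcal T)$ iff $T\in\mathcal T$. It is optimum if $N=(d+1)v^t$. -}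

module Defs where

open import Data.Nat using (ℕ; _+_; _*_; _^_; _≤_)
open import Data.Nat.Primality using (Prime)
open import Data.Nat.Properties using (<-≤-trans; +-monoʳ-<)
open import Data.Fin using (Fin; toℕ; fromℕ<)
open import Data.Fin.Properties using (toℕ<n)
open import Data.List using (List; length)
open import Data.List.Membership.Propositional using (_∈_)
open import Data.List.Relation.Unary.Any using (Any)
open import Data.List.Relation.Unary.Unique.Propositional using (Unique)
open import Data.Product using (_×_; ∃)
open import Data.Vec using (Vec; lookup)
open import Data.Vec.Functional using (foldr)
open import Function.Bundles using (_⇔_)
open import Function.Definitions using (Injective)
open import Level using (0ℓ)
open import Relation.Binary.PropositionalEquality using (_≡_)
open import Relation.Unary using (Pred; Satisfiable; _⊆_)

record PrimePowerFactorization (v : ℕ) : Set where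
  field
    s             : ℕ
    base          : Fin s → ℕ
    exponent      : Fin s → ℕ
    base-prime    : ∀ i → Prime (base i)
    base-distinct : Injective _≡_ _≡_ base
    exponent-pos  : ∀ i → 1 ≤ exponent i

  q : Fin s → ℕ
  q i = base i ^ exponent i

  field
    product-q : foldr _*_ 1 q ≡ v

IsMinimumOf : {s : ℕ} → ℕ → (Fin s → ℕ) → Set
IsMinimumOf k q = (∃ λ i → q i ≡ k) × (∀ i → k ≤ q i)

Array : (N k v : ℕ) → Set
Array N k v = Fin N → Fin k → Fin v

-- Columns are numbered from 0, so the starting column i satisfies i + t ≤ k.
-- For t ≥ 1, propositional equality of these records coincides with equality
-- of the sets {(i , x₀) , … , (i + t - 1 , x_{t-1})}.
record Interaction (t k v : ℕ) : Set where
  constructor interaction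
  field
    start  : ℕ
    .bound : start + t ≤ k
    values : Vec (Fin v) t

open Interaction public using (start; values)

column : ∀ {t k v} → Interaction t k v → Fin t → Fin k
column (interaction i i+t≤k _) j =
  fromℕ< (<-≤-trans (+-monoʳ-< i (toℕ<n j)) i+t≤k)

ρ : ∀ {N t k v} → Array N k v → Interaction t k v → Pred (Fin N) 0ℓ
ρ A T r = ∀ j → A r (column T j) ≡ lookup (values T) j

ρ⋃ : ∀ {N t k v} → Array N k v → List (Interaction t k v) → Pred (Fin N) 0ℓ
ρ⋃ A 𝒯 r = Any (λ T → ρ A T r) 𝒯

-- A set of exactly d interactions is a duplicate-free list of length d.
record CDA (d t N k v : ℕ) : Set where
  field
    array     : Array N k v
    covering  : (T : Interaction t k v) → Satisfiable (ρ array T)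
    detecting : (𝒯 : List (Interaction t k v)) → Unique 𝒯 → length 𝒯 ≡ d →
                (T : Interaction t k v) → (ρ array T ⊆ ρ⋃ array 𝒯) ⇔ (T ∈ 𝒯)

Optimum : ∀ {d t N k v} → CDA d t N k v → Set
Optimum {d = d} {t = t} {N = N} {v = v} _ = N ≡ (d + 1) * v ^ t

{-# OPTIONS --safe #-}
module Submission where

-- An orthogonal family on a set W consists of k maps Fᵢ(x , y), bijective in x for fixed y, any
-- two of which determine y.  Index the rows by x ∈ Vᵗ and by y in a set of d + 1 levels, and let
-- column j have the entry F_{⌊j/t⌋}(x_{j mod t} , y).  Among t consecutive columns every residue
-- modulo t occurs once, so each tuple has exactly one row at each level.  Two different windows
-- contain different columns of one residue class, so rows lying in two distinct interactions have
-- the same level, and d interactions cannot exhaust the d + 1 rows of another one.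
--
-- Families multiply along v = q₁ ⋯ qₛ, and for a prime power q the maps x + a y over a field of
-- order q form one.  The field is the set of roots of X^q - X.  To split this polynomial, adjoin
-- roots of monic polynomials to ℤ/p, one at a time, without any irreducibility.  Among the finite
-- nontrivial rings obtained in this way or their quotients, one that needs the fewest elements has
-- no proper nonzero ideals.  This argument is classical, but the existence of a family is a finite
-- search and therefore stable under double negation.

open import Algebra.Bundles using (CommutativeRing)
import Algebra.Consequences.Setoid as Consequences
import Algebra.Definitions as Definitions
open import Algebra.Morphism.Bundles using (RingHomomorphism)
import Algebra.Morphism.Construct.Composition as Composition
import Algebra.Properties.AbelianGroup as AbelianGroupProperties
import Algebra.Properties.CommutativeSemiring.Binomial as Binomial
import Algebra.Properties.CommutativeSemiring.Exp as CommutativeExp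
import Algebra.Properties.Monoid.Sum as MonoidSum
import Algebra.Properties.Ring as RingProperties
import Algebra.Properties.Semiring.Exp as Exp
import Algebra.Properties.Semiring.Mult as Mult
import Algebra.Solver.Ring.NaturalCoefficients.Default as SemiringSolver
open import Data.Empty using (⊥-elim)
open import Data.Fin as Fin using (Fin; zero; suc; toℕ; fromℕ; fromℕ<; inject₁; inject≤; combine; remQuot; finToFun; funToFin; punchIn; punchOut)
open import Data.Fin.Properties using (toℕ<n; toℕ-fromℕ; toℕ-fromℕ<; toℕ-inject₁; toℕ-injective; fromℕ<-cong; inject≤-injective; <⇒≢; any?; all?; remQuot-combine; combine-remQuot; combine-injective; finToFun-funToFin; injective⇒≤; punchOut-injective; punchIn-punchOut; pigeonhole; sequence)
import Data.Integer as ℤ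
import Data.Integer.DivMod as ℤ
import Data.Integer.Properties as ℤₚ
open import Data.List as List using (List; length)
open import Data.List.Membership.Propositional using (_∈_; lose)
open import Data.List.Membership.Propositional.Properties using (∈-lookup)
import Data.List.Relation.Unary.Any as Any
open import Data.List.Relation.Unary.Any.Properties using (lookup-index)
open import Data.Nat as ℕ using (ℕ; zero; suc; _∸_; _!; _≤_; _<_)
open import Data.Nat.Combinatorics using (_C_; nCk≡n!/k![n-k]!; k![n∸k]!∣n!; nCn≡1)
open import Data.Nat.Divisibility using (_∣_; divides; ∣⇒≤; m∣m*n)
open import Data.Nat.DivMod using (_/_; _%_; m%n<n; m≡m%n+[m/n]*n; m/n*n≡m; m<n*o⇒m/o<n; %-distribˡ-+; m%n%n≡m%n; [m+kn]%n≡m%n; m<n⇒m%n≡m)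
open import Data.Nat.Induction using (<-rec)
open import Data.Nat.Primality using (Prime; euclidsLemma; prime⇒nonTrivial; prime⇒nonZero)
import Data.Nat.Properties as ℕₚ
open import Data.Nat.Tactic.RingSolver using (solve-∀)
open import Data.Product using (Σ; ∃; ∃₂; _×_; _,_; proj₁; proj₂)
open import Data.Sum using (_⊎_; inj₁; inj₂; [_,_]′)
open import Data.Vec as Vec using (Vec; []; _∷_; _∷ʳ_; head; tail; lookup; map; replicate; tabulate; zipWith)
open import Data.Vec.Functional using (foldr)
open import Data.Vec.Properties using (map-id; map-∘; lookup-map; tabulate-cong; tabulate∘lookup)
open import Effect.Monad using (RawMonad)
open import Function using (id; _∘_)
open import Function.Bundles using (mk⇔)
open import Function.Definitions using (Injective)
open import Level using (0ℓ)
open import Relation.Binary using (Rel; IsEquivalence; Setoid)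
open import Relation.Binary.Definitions using (tri<; tri≈; tri>)
open import Relation.Binary.PropositionalEquality as ≡ using (_≡_; _≢_)
import Relation.Binary.Reasoning.Setoid as SetoidReasoning
open import Relation.Nullary using (¬_; Dec; yes; no; contradiction)
open import Relation.Nullary.Decidable using (_×-dec_; _→-dec_; ¬?; decidable-stable)
open import Relation.Nullary.Negation using (¬¬-Monad; ¬¬-map)
open import Relation.Unary using (_⊆_)
open import Defs

-- Quotients and extensions of commutative rings

Ring₀ : Set₁
Ring₀ = CommutativeRing 0ℓ 0ℓ

Hom : Ring₀ → Ring₀ → Set
Hom A B = RingHomomorphism (CommutativeRing.rawRing A) (CommutativeRing.rawRing B)

Nontrivial : Ring₀ → Set
Nontrivial A = ¬ (1# ≈ 0#)
  where open CommutativeRing A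

-- Repetitions are allowed, so `N` is only an upper bound for the number of classes and no decision
-- procedure for `≈` is needed.
Cover : ℕ → Ring₀ → Set
Cover N A = ∃ λ (e : Fin N → Carrier) → ∀ x → ∃ λ i → x ≈ e i
  where open CommutativeRing A

module _ {Carrier : Set} {_≈_ : Rel Carrier 0ℓ} (isEquivalence : IsEquivalence _≈_) where
  open Definitions _≈_
  private
    S : Setoid 0ℓ 0ℓ
    S = record { isEquivalence = isEquivalence }
    open Consequences S

  mkCommutativeRing : (_+_ _*_ : Carrier → Carrier → Carrier) (-_ : Carrier → Carrier) (0# 1# : Carrier) →
    Congruent₂ _+_ → Associative _+_ → Commutative _+_ → LeftIdentity 0# _+_ →
    Congruent₁ -_ → LeftInverse 0# -_ _+_ →
    Congruent₂ _*_ → Associative _*_ → Commutative _*_ → LeftIdentity 1# _*_ →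
    _*_ DistributesOverˡ _+_ → Ring₀
  mkCommutativeRing _+_ _*_ -_ 0# 1# +-cong +-assoc +-comm +-idˡ -‿cong invˡ *-cong *-assoc *-comm *-idˡ distˡ = record
    { _+_ = _+_
    ; _*_ = _*_
    ; -_ = -_
    ; 0# = 0#
    ; 1# = 1#
    ; isCommutativeRing = record
      { isRing = record
        { +-isAbelianGroup = record
          { isGroup = record
            { isMonoid = record
              { isSemigroup = record
                { isMagma = record { isEquivalence = isEquivalence ; ∙-cong = +-cong }
                ; assoc = +-assoc
                }
              ; identity = comm∧idˡ⇒id +-comm +-idˡ
              }
            ; inverse = comm∧invˡ⇒inv +-comm invˡ
            ; ⁻¹-cong = -‿cong
            }
          ; comm = +-comm
          }
        ; *-cong = *-cong
        ; *-assoc = *-assoc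
        ; *-identity = comm∧idˡ⇒id *-comm *-idˡ
        ; distrib = comm∧distrˡ⇒distr +-cong *-comm distˡ
        }
      ; *-comm = *-comm
      }
    }

module _ {A B : Ring₀} where
  private
    module A = CommutativeRing A
    module B = CommutativeRing B

  mkHom : (f : A.Carrier → B.Carrier) → (∀ {x y} → x A.≈ y → f x B.≈ f y) →
          (∀ x y → f (x A.+ y) B.≈ f x B.+ f y) → f A.0# B.≈ B.0# →
          (∀ x y → f (x A.* y) B.≈ f x B.* f y) → f A.1# B.≈ B.1# →
          (∀ x → f (A.- x) B.≈ B.- f x) → Hom A B
  mkHom f cong + 0# * 1# - = record
    { ⟦_⟧ = f
    ; isRingHomomorphism = record
      { isSemiringHomomorphism = record
        { isNearSemiringHomomorphism = record
          { +-isMonoidHomomorphism = record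
            { isMagmaHomomorphism = record
              { isRelHomomorphism = record { cong = cong }
              ; homo = +
              }
            ; ε-homo = 0#
            }
          ; *-homo = *
          }
        ; 1#-homo = 1#
        }
      ; -‿homo = -
      }
    }

module Quotient (A : Ring₀) (r : CommutativeRing.Carrier A) where
  open CommutativeRing A hiding (zero)
  open SetoidReasoning setoid
  open AbelianGroupProperties +-abelianGroup using (⁻¹-∙-comm)
  open RingProperties ring using (-‿distribʳ-*)
  private module S = SemiringSolver commutativeSemiring

  -- Congruence modulo the principal ideal of `r`. The quotient keeps the carrier of `A` and only
  -- coarsens its equality, so representatives in `A` still serve.
  _~_ : Rel Carrier 0ℓ
  x ~ y = ∃ λ h → x ≈ y + r * h

  ≈⇒~ : ∀ {x y} → x ≈ y → x ~ y
  ≈⇒~ {x} {y} x≈y = 0# , (begin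
    x            ≈⟨ x≈y ⟩
    y            ≈⟨ +-identityʳ y ⟨
    y + 0#       ≈⟨ +-congˡ (zeroʳ r) ⟨
    y + r * 0#   ∎)

  private
    ~-sym : ∀ {x y} → x ~ y → y ~ x
    ~-sym {x} {y} (h , x≈) = - h , (begin
      y                              ≈⟨ +-identityʳ y ⟨
      y + 0#                         ≈⟨ +-congˡ (zeroʳ r) ⟨
      y + r * 0#                     ≈⟨ +-congˡ (*-congˡ (-‿inverseʳ h)) ⟨
      y + r * (h - h)                ≈⟨ S.solve 4 (λ y r h n → y S.:+ r S.:* (h S.:+ n) S.:=
                                          y S.:+ r S.:* h S.:+ r S.:* n) refl y r h (- h) ⟩
      y + r * h + r * - h            ≈⟨ +-congʳ x≈ ⟨
      x + r * - h                    ∎)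

    ~-trans : ∀ {x y z} → x ~ y → y ~ z → x ~ z
    ~-trans {x} {y} {z} (h , x≈) (g , y≈) = g + h , (begin
      x                    ≈⟨ x≈ ⟩
      y + r * h            ≈⟨ +-congʳ y≈ ⟩
      z + r * g + r * h    ≈⟨ S.solve 4 (λ z r g h → z S.:+ r S.:* g S.:+ r S.:* h S.:= z S.:+ r S.:* (g S.:+ h)) refl z r g h ⟩
      z + r * (g + h)      ∎)

    ~-isEquivalence : IsEquivalence _~_
    ~-isEquivalence = record { refl = ≈⇒~ refl ; sym = ~-sym ; trans = ~-trans }

    ~-+-cong : ∀ {x x′ y y′} → x ~ x′ → y ~ y′ → (x + y) ~ (x′ + y′)
    ~-+-cong {x} {x′} {y} {y′} (h , x≈) (g , y≈) = h + g , (begin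
      x + y                              ≈⟨ +-cong x≈ y≈ ⟩
      (x′ + r * h) + (y′ + r * g)        ≈⟨ S.solve 5 (λ x y r h g →
                                              (x S.:+ r S.:* h) S.:+ (y S.:+ r S.:* g) S.:=
                                              (x S.:+ y) S.:+ r S.:* (h S.:+ g)) refl x′ y′ r h g ⟩
      (x′ + y′) + r * (h + g)            ∎)

    ~-*-cong : ∀ {x x′ y y′} → x ~ x′ → y ~ y′ → (x * y) ~ (x′ * y′)
    ~-*-cong {x} {x′} {y} {y′} (h , x≈) (g , y≈) = x′ * g + h * (y′ + r * g) , (begin
      x * y                              ≈⟨ *-cong x≈ y≈ ⟩
      (x′ + r * h) * (y′ + r * g)        ≈⟨ S.solve 5 (λ x y r h g →
                                              (x S.:+ r S.:* h) S.:* (y S.:+ r S.:* g) S.:=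
                                              (x S.:* y) S.:+ r S.:* (x S.:* g S.:+ h S.:* (y S.:+ r S.:* g)))
                                              refl x′ y′ r h g ⟩
      (x′ * y′) + r * (x′ * g + h * (y′ + r * g)) ∎)

    ~-neg-cong : ∀ {x y} → x ~ y → (- x) ~ (- y)
    ~-neg-cong {x} {y} (h , x≈) = - h , (begin
      - x                  ≈⟨ -‿cong x≈ ⟩
      - (y + r * h)        ≈⟨ ⁻¹-∙-comm y (r * h) ⟨
      - y + - (r * h)      ≈⟨ +-congˡ (-‿distribʳ-* r h) ⟩
      - y + r * - h        ∎)

  quotient : Ring₀
  quotient = mkCommutativeRing ~-isEquivalence _+_ _*_ -_ 0# 1#
    ~-+-cong (λ x y z → ≈⇒~ (+-assoc x y z)) (λ x y → ≈⇒~ (+-comm x y)) (λ x → ≈⇒~ (+-identityˡ x))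
    ~-neg-cong (λ x → ≈⇒~ (-‿inverseˡ x))
    ~-*-cong (λ x y z → ≈⇒~ (*-assoc x y z)) (λ x y → ≈⇒~ (*-comm x y)) (λ x → ≈⇒~ (*-identityˡ x))
    (λ x y z → ≈⇒~ (distribˡ x y z))

  π : Hom A quotient
  π = mkHom {A} {quotient} id ≈⇒~ (λ _ _ → ≈⇒~ refl) (≈⇒~ refl) (λ _ _ → ≈⇒~ refl) (≈⇒~ refl) (λ _ → ≈⇒~ refl)

  r~0 : r ~ 0#
  r~0 = 1# , sym (trans (+-identityˡ (r * 1#)) (*-identityʳ r))

-- Reduction modulo a monic polynomial

module _ (B : Ring₀) where
  open CommutativeRing B

  -- A vector a₀, …, aₙ₋₁ encodes the monic polynomial a₀ + a₁ X + ⋯ + aₙ₋₁ Xⁿ⁻¹ + Xⁿ.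
  monic : ∀ {n} → Vec Carrier n → Carrier → Carrier
  monic []      x = 1#
  monic (a ∷ l) x = a + x * monic l x

module Reduction {A B : Ring₀} (φ : Hom A B) (ξ : CommutativeRing.Carrier B)
                 {n : ℕ} (l : Vec (CommutativeRing.Carrier A) (suc n))
                 (ξ-root : CommutativeRing._≈_ B (monic B (map (RingHomomorphism.⟦_⟧ φ) l) ξ) (CommutativeRing.0# B)) where
  open CommutativeRing B hiding (zero)
  open RingHomomorphism φ
  open Exp semiring using (_^_)
  open RingProperties ring using (-1*x≈-x)
  open AbelianGroupProperties +-abelianGroup using (inverseʳ-unique)
  private
    module A = CommutativeRing A
    module S = SemiringSolver commutativeSemiring

    poly : ∀ {m} → Vec A.Carrier m → Carrier
    poly []      = 0#
    poly (a ∷ c) = ⟦ a ⟧ + ξ * poly c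

    poly-+ : ∀ {m} (c d : Vec A.Carrier m) → poly c + poly d ≈ poly (zipWith A._+_ c d)
    poly-+ []      []      = +-identityˡ _
    poly-+ (a ∷ c) (b ∷ d) = trans
      (S.solve 5 (λ a b x p q → (a S.:+ x S.:* p) S.:+ (b S.:+ x S.:* q) S.:= (a S.:+ b) S.:+ x S.:* (p S.:+ q)) refl
        ⟦ a ⟧ ⟦ b ⟧ ξ (poly c) (poly d))
      (+-cong (sym (+-homo a b)) (*-congˡ (poly-+ c d)))

    poly-* : ∀ {m} a (c : Vec A.Carrier m) → ⟦ a ⟧ * poly c ≈ poly (map (a A.*_) c)
    poly-* a []      = zeroʳ _
    poly-* a (b ∷ c) = trans
      (S.solve 4 (λ a b x p → a S.:* (b S.:+ x S.:* p) S.:= (a S.:* b) S.:+ x S.:* (a S.:* p)) refl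
        ⟦ a ⟧ ⟦ b ⟧ ξ (poly c))
      (+-cong (sym (*-homo a b)) (*-congˡ (poly-* a c)))

    poly-0 : ∀ m → poly (replicate m A.0#) ≈ 0#
    poly-0 zero    = refl
    poly-0 (suc m) = trans (+-cong 0#-homo (trans (*-congˡ (poly-0 m)) (zeroʳ ξ))) (+-identityˡ 0#)

    -- This isolates the one term whose degree becomes too large when a reduced expression is
    -- multiplied by `ξ`.
    poly-top : ∀ m (c : Vec A.Carrier (suc m)) →
               ∃₂ λ (c′ : Vec A.Carrier m) a → poly c ≈ poly c′ + ⟦ a ⟧ * ξ ^ m
    poly-top zero    (a ∷ []) = [] , a ,
      trans (+-cong (sym (*-identityʳ ⟦ a ⟧)) (zeroʳ ξ)) (+-comm _ _)
    poly-top (suc m) (b ∷ c) with poly-top m c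
    ... | c′ , a , eq = b ∷ c′ , a , trans (+-congˡ (*-congˡ eq))
      (S.solve 5 (λ b x p a y → b S.:+ x S.:* (p S.:+ a S.:* y) S.:= (b S.:+ x S.:* p) S.:+ a S.:* (x S.:* y)) refl
        ⟦ b ⟧ ξ (poly c′) ⟦ a ⟧ (ξ ^ m))

    monic≈poly : ∀ {m} (c : Vec A.Carrier m) → monic B (map ⟦_⟧ c) ξ ≈ poly c + ξ ^ m
    monic≈poly []      = sym (+-identityˡ _)
    monic≈poly {suc m} (a ∷ c) = trans (+-congˡ (*-congˡ (monic≈poly c)))
      (S.solve 4 (λ a x p y → a S.:+ x S.:* (p S.:+ y) S.:= (a S.:+ x S.:* p) S.:+ x S.:* y) refl
        ⟦ a ⟧ ξ (poly c) (ξ ^ m))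

  -- The values at `ξ` of polynomials of degree at most `n` over `A`. They form a subring containing
  -- `ξ` and the image of `A`, hence exhaust any ring generated by these.
  Reducible : Carrier → Set
  Reducible t = ∃ λ (c : Vec A.Carrier (suc n)) → t ≈ poly c

  reducible-≈ : ∀ {t u} → t ≈ u → Reducible u → Reducible t
  reducible-≈ t≈u (c , u≈) = c , trans t≈u u≈

  reducible-+ : ∀ {t u} → Reducible t → Reducible u → Reducible (t + u)
  reducible-+ (c , t≈) (d , u≈) = zipWith A._+_ c d , trans (+-cong t≈ u≈) (poly-+ c d)

  reducible-⟦⟧* : ∀ a {t} → Reducible t → Reducible (⟦ a ⟧ * t)
  reducible-⟦⟧* a (c , t≈) = map (a A.*_) c , trans (*-congˡ t≈) (poly-* a c)

  reducible-neg : ∀ {t} → Reducible t → Reducible (- t)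
  reducible-neg {t} red = reducible-≈
    (sym (trans (*-congʳ (trans (-‿homo A.1#) (-‿cong 1#-homo))) (-1*x≈-x t))) (reducible-⟦⟧* (A.- A.1#) red)

  reducible-⟦⟧ : ∀ a → Reducible ⟦ a ⟧
  reducible-⟦⟧ a = a ∷ replicate n A.0# ,
    sym (trans (+-congˡ (trans (*-congˡ (poly-0 n)) (zeroʳ ξ))) (+-identityʳ _))

  private
    -- The equation `ξ-root` rewrites the leading power as the negative of the lower terms.
    reducible-ξ^ : Reducible (ξ ^ suc n)
    reducible-ξ^ = reducible-≈
      (inverseʳ-unique _ _ (trans (sym (monic≈poly l)) ξ-root)) (reducible-neg (l , refl))

    reducible-ξ* : ∀ {t} → Reducible t → Reducible (ξ * t)
    -- Prepending `A.0#` to the coefficients multiplies the value by `ξ`; the overflowing leading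
    -- term is then reduced by `reducible-ξ^`.
    reducible-ξ* (c , t≈) with poly-top (suc n) (A.0# ∷ c)
    ... | c′ , a , eq = reducible-≈
      (trans (*-congˡ t≈) (trans (sym (+-identityˡ _)) (trans (+-congʳ (sym 0#-homo)) eq)))
      (reducible-+ (c′ , refl) (reducible-⟦⟧* a reducible-ξ^))

    reducible-poly* : ∀ {m} (c : Vec A.Carrier m) {t} → Reducible t → Reducible (poly c * t)
    reducible-poly* []      red = reducible-≈ (trans (zeroˡ _) (sym 0#-homo)) (reducible-⟦⟧ A.0#)
    reducible-poly* (a ∷ c) {t} red = reducible-≈
      (trans (distribʳ t ⟦ a ⟧ _) (+-congˡ (*-assoc ξ (poly c) t)))
      (reducible-+ (reducible-⟦⟧* a red) (reducible-ξ* (reducible-poly* c red)))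

  reducible-ξ : Reducible ξ
  reducible-ξ = reducible-≈ (sym (trans (*-congˡ 1#-homo) (*-identityʳ ξ))) (reducible-ξ* (reducible-⟦⟧ A.1#))

  reducible-* : ∀ {t u} → Reducible t → Reducible u → Reducible (t * u)
  reducible-* (c , t≈) red = reducible-≈ (*-congʳ t≈) (reducible-poly* c red)

  reducible⇒cover : (∀ t → Reducible t) → ∀ {N} → Cover N A → Cover (N ℕ.^ suc n) B
  reducible⇒cover red {N} (e , e-covers) = value (suc n) , λ t →
    let c , t≈ = red t
        k , c≈ = value-covers c
    in k , trans t≈ c≈
    where
    value : ∀ m → Fin (N ℕ.^ m) → Carrier
    value zero    _ = 0#
    value (suc m) k = ⟦ e (proj₁ (remQuot {N} (N ℕ.^ m) k)) ⟧ + ξ * value m (proj₂ (remQuot {N} (N ℕ.^ m) k))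

    value-covers : ∀ {m} (c : Vec A.Carrier m) → ∃ λ k → poly c ≈ value m k
    value-covers []      = zero , refl
    value-covers {suc m} (a ∷ c) with e-covers a | value-covers c
    ... | i , a≈ | k , c≈ = combine i k , trans
      (+-cong (⟦⟧-cong a≈) (*-congˡ c≈))
      (reflexive (≡.cong (λ iq → ⟦ e (proj₁ iq) ⟧ + ξ * value m (proj₂ iq)) (≡.sym (remQuot-combine i k))))

-- Linear recurrences

module Recurrence {Value : Set} {n : ℕ} (initial : Vec Value (suc n)) (next : Vec Value (suc n) → Value) where

  -- The state holds `suc n` consecutive terms, which turns a recurrence of order `suc n` into a
  -- structural recursion on the index.
  window : ℕ → Vec Value (suc n)
  window zero    = initial
  window (suc i) = tail (window i) ∷ʳ next (window i)

  value : ℕ → Value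
  value i = head (window i)

  private
    lookup-zero : ∀ {m} (w : Vec Value (suc m)) → lookup w zero ≡ head w
    lookup-zero (_ ∷ _) = ≡.refl

    lookup-suc : ∀ {m} (w : Vec Value (suc m)) j → lookup w (suc j) ≡ lookup (tail w) j
    lookup-suc (_ ∷ _) _ = ≡.refl

    lookup-∷ʳ-inject₁ : ∀ {m} (w : Vec Value m) b j → lookup (w ∷ʳ b) (inject₁ j) ≡ lookup w j
    lookup-∷ʳ-inject₁ (a ∷ w) b zero    = ≡.refl
    lookup-∷ʳ-inject₁ (a ∷ w) b (suc j) = lookup-∷ʳ-inject₁ w b j

    lookup-∷ʳ-fromℕ : ∀ {m} (w : Vec Value m) b → lookup (w ∷ʳ b) (fromℕ m) ≡ b
    lookup-∷ʳ-fromℕ []      b = ≡.refl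
    lookup-∷ʳ-fromℕ (a ∷ w) b = lookup-∷ʳ-fromℕ w b

    -- Position `suc j` of one window is position `j` of the next. Since `inject₁ j` is not
    -- structurally smaller than `suc j`, the recursion descends on the number `k`.
    lookup-window′ : ∀ k i (j : Fin (suc n)) → toℕ j ≡ k → lookup (window i) j ≡ value (toℕ j ℕ.+ i)
    lookup-window′ k       i zero    _  = lookup-zero (window i)
    lookup-window′ (suc k) i (suc j) eq = begin
      lookup (window i) (suc j)              ≡⟨ lookup-suc (window i) j ⟩
      lookup (tail (window i)) j             ≡⟨ lookup-∷ʳ-inject₁ (tail (window i)) _ j ⟨
      lookup (window (suc i)) (inject₁ j)    ≡⟨ lookup-window′ k (suc i) (inject₁ j)
                                                  (≡.trans (toℕ-inject₁ j) (ℕₚ.suc-injective eq)) ⟩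
      value (toℕ (inject₁ j) ℕ.+ suc i)      ≡⟨ ≡.cong (λ m → value (m ℕ.+ suc i)) (toℕ-inject₁ j) ⟩
      value (toℕ j ℕ.+ suc i)                ≡⟨ ≡.cong value (ℕₚ.+-suc (toℕ j) i) ⟩
      value (suc (toℕ j) ℕ.+ i)              ∎
      where open ≡.≡-Reasoning

  lookup-window : ∀ i j → lookup (window i) j ≡ value (toℕ j ℕ.+ i)
  lookup-window i j = lookup-window′ (toℕ j) i j ≡.refl

  value-next : ∀ i → value (suc n ℕ.+ i) ≡ next (window i)
  value-next i = begin
    value (suc n ℕ.+ i)                    ≡⟨ ≡.cong value (ℕₚ.+-suc n i) ⟨
    value (n ℕ.+ suc i)                    ≡⟨ ≡.cong (λ m → value (m ℕ.+ suc i)) (toℕ-fromℕ n) ⟨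
    value (toℕ (fromℕ n) ℕ.+ suc i)        ≡⟨ lookup-window (suc i) (fromℕ n) ⟨
    lookup (window (suc i)) (fromℕ n)      ≡⟨ lookup-∷ʳ-fromℕ (tail (window i)) _ ⟩
    next (window i)                        ∎
    where open ≡.≡-Reasoning

-- Adjoining a root through the shift operator

module Extension (A : Ring₀) where
  open CommutativeRing A hiding (zero)
  open SetoidReasoning setoid
  open AbelianGroupProperties +-abelianGroup using (⁻¹-∙-comm)
  open RingProperties ring using (-1*x≈-x; -‿distribʳ-*)
  private module S = SemiringSolver commutativeSemiring

  -- Unevaluated polynomial expressions. They are later identified through their action on
  -- sequences, which replaces polynomial arithmetic and normal forms.
  data Term : Set where
    con     : Carrier → Term
    X       : Term
    _⊕_ _⊗_ : Term → Term → Term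
    ⊖_      : Term → Term

  Seq : Set
  Seq = ℕ → Carrier

  _≐_ : Rel Seq 0ℓ
  s ≐ s′ = ∀ i → s i ≈ s′ i

  -- X acts as the shift.
  act : Term → Seq → Seq
  act (con a) s i = a * s i
  act X       s i = s (suc i)
  act (t ⊕ u) s i = act t s i + act u s i
  act (t ⊗ u) s   = act t (act u s)
  act (⊖ t)   s i = - act t s i

  act-cong : ∀ t {s s′} → s ≐ s′ → act t s ≐ act t s′
  act-cong (con a) eq i = *-congˡ (eq i)
  act-cong X       eq i = eq (suc i)
  act-cong (t ⊕ u) eq i = +-cong (act-cong t eq i) (act-cong u eq i)
  act-cong (t ⊗ u) eq   = act-cong t (act-cong u eq)
  act-cong (⊖ t)   eq i = -‿cong (act-cong t eq i)

  act-+ : ∀ t s s′ → act t (λ i → s i + s′ i) ≐ (λ i → act t s i + act t s′ i)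
  act-+ (con a) s s′ i = distribˡ a (s i) (s′ i)
  act-+ X       s s′ i = refl
  act-+ (t ⊕ u) s s′ i = trans (+-cong (act-+ t s s′ i) (act-+ u s s′ i))
    (S.solve 4 (λ a b c d → (a S.:+ b) S.:+ (c S.:+ d) S.:= (a S.:+ c) S.:+ (b S.:+ d)) refl
      (act t s i) (act t s′ i) (act u s i) (act u s′ i))
  act-+ (t ⊗ u) s s′ i = trans (act-cong t (act-+ u s s′) i) (act-+ t _ _ i)
  act-+ (⊖ t)   s s′ i = trans (-‿cong (act-+ t s s′ i)) (sym (⁻¹-∙-comm _ _))

  act-scale : ∀ t a s → act t (λ i → a * s i) ≐ (λ i → a * act t s i)
  act-scale (con b) a s i = S.solve 3 (λ a b c → b S.:* (a S.:* c) S.:= a S.:* (b S.:* c)) refl a b (s i)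
  act-scale X       a s i = refl
  act-scale (t ⊕ u) a s i = trans (+-cong (act-scale t a s i) (act-scale u a s i)) (sym (distribˡ a _ _))
  act-scale (t ⊗ u) a s i = trans (act-cong t (act-scale u a s) i) (act-scale t a _ i)
  act-scale (⊖ t)   a s i = trans (-‿cong (act-scale t a s i)) (-‿distribʳ-* a _)

  act-neg : ∀ t s → act t (λ i → - s i) ≐ (λ i → - act t s i)
  act-neg t s i = begin
    act t (λ j → - s j) i        ≈⟨ act-cong t (λ j → sym (-1*x≈-x (s j))) i ⟩
    act t (λ j → - 1# * s j) i   ≈⟨ act-scale t (- 1#) s i ⟩
    - 1# * act t s i             ≈⟨ -1*x≈-x _ ⟩
    - act t s i                  ∎

  act-zero : ∀ t {s} → s ≐ (λ _ → 0#) → act t s ≐ (λ _ → 0#)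
  act-zero t {s} s≐0 i = begin
    act t s i                  ≈⟨ act-cong t (λ j → trans (s≐0 j) (sym (zeroˡ 0#))) i ⟩
    act t (λ j → 0# * 0#) i    ≈⟨ act-scale t 0# (λ _ → 0#) i ⟩
    0# * act t (λ _ → 0#) i    ≈⟨ zeroˡ _ ⟩
    0#                         ∎

  act-shift : ∀ t s i → act t (λ j → s (suc j)) i ≈ act t s (suc i)
  act-shift (con a) s i = refl
  act-shift X       s i = refl
  act-shift (t ⊕ u) s i = +-cong (act-shift t s i) (act-shift u s i)
  act-shift (t ⊗ u) s i = trans (act-cong t (act-shift u s) i) (act-shift t (act u s) i)
  act-shift (⊖ t)   s i = -‿cong (act-shift t s i)

  -- Every term acts linearly and commutes with the shift, and induction on `t` reduces to these
  -- facts. This yields both the commutativity of `⊗` and the stability of the recurrent sequences.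
  act-comm : ∀ t u s → act t (act u s) ≐ act u (act t s)
  act-comm (con a) u s i = sym (act-scale u a s i)
  act-comm X       u s i = sym (act-shift u s i)
  act-comm (t ⊕ t′) u s i = trans (+-cong (act-comm t u s i) (act-comm t′ u s i)) (sym (act-+ u _ _ i))
  act-comm (t ⊗ t′) u s i = trans (act-cong t (act-comm t′ u s) i) (act-comm t u (act t′ s) i)
  act-comm (⊖ t)   u s i = trans (-‿cong (act-comm t u s i)) (sym (act-neg u _ i))

  -- Terms are compared on the sequences annihilated by `F`. Since `F` acts on them as zero, the
  -- resulting ring is a quotient of A[X]/(F).
  module Adjoin (F : Term) where

    Recurrent : Seq → Set
    Recurrent s = act F s ≐ (λ _ → 0#)

    -- In `t ⊗ u` the term `t` is applied to `act u s`, which must again be recurrent for `≋` to be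
    -- compatible with products.
    act-recurrent : ∀ t {s} → Recurrent s → Recurrent (act t s)
    act-recurrent t {s} rec i = trans (act-comm F t s i) (act-zero t rec i)

    -- A record rather than a function, so that the terms can be inferred.
    infix 4 _≋_
    record _≋_ (t u : Term) : Set where
      constructor mk≋
      field at : ∀ s → Recurrent s → act t s ≐ act u s
    open _≋_ public

    private
      ≋-isEquivalence : IsEquivalence _≋_
      ≋-isEquivalence = record
        { refl  = mk≋ λ _ _ _ → refl
        ; sym   = λ p → mk≋ λ s rec i → sym (at p s rec i)
        ; trans = λ p q → mk≋ λ s rec i → trans (at p s rec i) (at q s rec i)
        }

    extension : Ring₀
    extension = mkCommutativeRing ≋-isEquivalence _⊕_ _⊗_ ⊖_ (con 0#) (con 1#)
      (λ p q → mk≋ λ s rec i → +-cong (at p s rec i) (at q s rec i))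
      (λ t u v → mk≋ λ s rec i → +-assoc _ _ _)
      (λ t u → mk≋ λ s rec i → +-comm _ _)
      (λ t → mk≋ λ s rec i → trans (+-congʳ (zeroˡ _)) (+-identityˡ _))
      (λ p → mk≋ λ s rec i → -‿cong (at p s rec i))
      (λ t → mk≋ λ s rec i → trans (-‿inverseˡ _) (sym (zeroˡ _)))
      (λ {t} {t′} {u} {u′} p q → mk≋ λ s rec i →
        trans (act-cong t (at q s rec) i) (at p (act u′ s) (act-recurrent u′ rec) i))
      (λ t u v → mk≋ λ s rec i → refl)
      (λ t u → mk≋ λ s rec → act-comm t u s)
      (λ t → mk≋ λ s rec i → *-identityˡ _)
      (λ t u v → mk≋ λ s rec → act-+ t _ _)

    conHom : Hom A extension
    conHom = mkHom {A} {extension} con (λ eq → mk≋ λ s rec i → *-congʳ eq)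
      (λ x y → mk≋ λ s rec i → distribʳ _ _ _) (mk≋ λ s rec i → refl)
      (λ x y → mk≋ λ s rec i → *-assoc _ _ _) (mk≋ λ s rec i → refl)
      (λ x → mk≋ λ s rec i → sym (-‿distribˡ-* x (s i)))
      where open RingProperties ring using (-‿distribˡ-*)

    F≋0 : F ≋ con 0#
    F≋0 = mk≋ λ s rec i → trans (rec i) (sym (zeroˡ _))

  monicTerm : ∀ {n} → Vec Carrier n → Term
  monicTerm []      = con 1#
  monicTerm (a ∷ l) = con a ⊕ (X ⊗ monicTerm l)

  private
    dot : ∀ {n} → Vec Carrier n → Vec Carrier n → Carrier
    dot []      []      = 0#
    dot (a ∷ l) (b ∷ w) = a * b + dot l w

    -- As the leading coefficient is 1, the last summand is a bare term of `s`, and annihilation by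
    -- the polynomial can be solved for it as a recurrence.
    act-monicTerm : ∀ {n} (l w : Vec Carrier n) s i → (∀ j → lookup w j ≡ s (toℕ j ℕ.+ i)) →
                    act (monicTerm l) s i ≈ dot l w + s (n ℕ.+ i)
    act-monicTerm [] [] s i _ = trans (*-identityˡ (s i)) (sym (+-identityˡ (s i)))
    act-monicTerm {suc n} (a ∷ l) (b ∷ w) s i window = begin
      a * s i + act (monicTerm l) s (suc i)
        ≈⟨ +-cong (*-congˡ (reflexive (≡.sym (window zero))))
                  (act-monicTerm l w s (suc i) (λ j → ≡.trans (window (suc j)) (≡.cong s (≡.sym (ℕₚ.+-suc (toℕ j) i))))) ⟩
      a * b + (dot l w + s (n ℕ.+ suc i))
        ≈⟨ +-assoc _ _ _ ⟨
      a * b + dot l w + s (n ℕ.+ suc i)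
        ≡⟨ ≡.cong (λ k → a * b + dot l w + s k) (ℕₚ.+-suc n i) ⟩
      a * b + dot l w + s (suc n ℕ.+ i) ∎

  module _ {n} (l : Vec Carrier (suc n)) where
    open Adjoin (monicTerm l)

    private
      -- The sequence starts with `1#`, so at index 0 a constant acts on it as itself; hence
      -- `con 1#` and `con 0#` can agree only if `1# ≈ 0#` in `A`.
      open Recurrence (1# ∷ replicate n 0#) (λ w → - dot l w)

      value-recurrent : Recurrent value
      value-recurrent i = begin
        act (monicTerm l) value i                ≈⟨ act-monicTerm l (window i) value i (lookup-window i) ⟩
        dot l (window i) + value (suc n ℕ.+ i)   ≡⟨ ≡.cong (dot l (window i) +_) (value-next i) ⟩
        dot l (window i) - dot l (window i)      ≈⟨ -‿inverseʳ _ ⟩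
        0#                                       ∎

    extension-nontrivial : Nontrivial A → Nontrivial extension
    extension-nontrivial 1≉0 1≋0 = 1≉0 (begin
      1#        ≈⟨ *-identityˡ 1# ⟨
      1# * 1#   ≈⟨ at 1≋0 value value-recurrent 0 ⟩
      0# * 1#   ≈⟨ zeroˡ 1# ⟩
      0#        ∎)

    private
      monic-con : ∀ {m} (c : Vec Carrier m) → monic extension (map con c) X ≡ monicTerm c
      monic-con []      = ≡.refl
      monic-con (a ∷ c) = ≡.cong (λ t → con a ⊕ (X ⊗ t)) (monic-con c)

    X-root : monic extension (map con l) X ≋ con 0#
    X-root = ≡.subst (_≋ con 0#) (≡.sym (monic-con l)) F≋0

    extension-cover : ∀ {N} → Cover N A → Cover (N ℕ.^ suc n) extension
    extension-cover = reducible⇒cover reducible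
      where
      open Reduction {A} {extension} conHom X l X-root
      reducible : ∀ t → Reducible t
      reducible (con a) = reducible-⟦⟧ a
      reducible X       = reducible-ξ
      reducible (t ⊕ u) = reducible-+ (reducible t) (reducible u)
      reducible (t ⊗ u) = reducible-* (reducible t) (reducible u)
      reducible (⊖ t)   = reducible-neg (reducible t)

-- The Frobenius map

module _ {p : ℕ} (p-prime : Prime p) where

  prime∤! : ∀ {k} → k ℕ.< p → ¬ (p ∣ k !)
  prime∤! {zero}  _   p∣1 = ℕₚ.<⇒≱ (ℕ.nonTrivial⇒n>1 p {{prime⇒nonTrivial p-prime}}) (∣⇒≤ p∣1)
  prime∤! {suc k} k<p p∣ = [ (λ p∣k → ℕₚ.<⇒≱ k<p (∣⇒≤ p∣k)) , prime∤! (ℕₚ.<-trans (ℕₚ.n<1+n k) k<p) ]′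
    (euclidsLemma (suc k) (k !) p-prime p∣)

  prime∣! : p ∣ p !
  prime∣! = helper p {{prime⇒nonZero p-prime}}
    where
    helper : ∀ n .{{_ : ℕ.NonZero n}} → n ∣ n !
    helper (suc n) = m∣m*n (n !)

  -- `p` divides p! = C(p,k) k! (p - k)!, but neither of the two factorials on the right.
  prime∣C : ∀ {k} → 0 ℕ.< k → k ℕ.< p → p ∣ p C k
  prime∣C {k} 0<k k<p with euclidsLemma (p C k) (k ! ℕ.* (p ∸ k) !) p-prime
    (≡.subst (p ∣_) (≡.sym factorial) prime∣!)
    where
    instance _ = k ℕₚ.!* (p ∸ k) !≢0
    factorial : (p C k) ℕ.* (k ! ℕ.* (p ∸ k) !) ≡ p !
    factorial = ≡.trans (≡.cong (ℕ._* (k ! ℕ.* (p ∸ k) !)) (nCk≡n!/k![n-k]! (ℕₚ.<⇒≤ k<p)))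
      (m/n*n≡m (k![n∸k]!∣n! (ℕₚ.<⇒≤ k<p)))
  ... | inj₁ p∣C = p∣C
  ... | inj₂ p∣! = ⊥-elim ([ prime∤! k<p , prime∤! (ℕₚ.∸-monoʳ-< 0<k (ℕₚ.<⇒≤ k<p)) ]′
                           (euclidsLemma (k !) ((p ∸ k) !) p-prime p∣!))

Char : ℕ → Ring₀ → Set
Char p A = (p ×′ 1#) ≈ 0#
  where
  open CommutativeRing A
  open Mult semiring renaming (_×_ to _×′_)

module Frobenius (B : Ring₀) {p : ℕ} (p-prime : Prime p) (char : Char p B) where
  open CommutativeRing B hiding (zero)
  open Mult semiring renaming (_×_ to _×′_)
  open Exp semiring
  open Binomial commutativeSemiring using (theorem; binomialTerm)
  open MonoidSum +-monoid using (sum; sum-cong-≋; sum-replicate-zero; sum-init-last)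
  open SetoidReasoning setoid

  ∣⇒×≈0 : ∀ {n} → p ∣ n → ∀ z → n ×′ z ≈ 0#
  ∣⇒×≈0 (divides c ≡.refl) z = begin
    (c ℕ.* p) ×′ z           ≈⟨ ×-congʳ (c ℕ.* p) (*-identityˡ z) ⟨
    (c ℕ.* p) ×′ (1# * z)    ≈⟨ ×-assoc-* (c ℕ.* p) 1# z ⟨
    (c ℕ.* p) ×′ 1# * z      ≈⟨ *-congʳ (×-assocˡ 1# c p) ⟨
    c ×′ (p ×′ 1#) * z       ≈⟨ *-congʳ (×-congʳ c char) ⟩
    c ×′ 0# * z              ≈⟨ ×-assoc-* c 0# z ⟩
    c ×′ (0# * z)            ≈⟨ ×-comm-* c 0# z ⟨
    0# * (c ×′ z)            ≈⟨ zeroˡ _ ⟩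
    0#                       ∎

  frobenius-+ : ∀ x y → (x + y) ^ p ≈ x ^ p + y ^ p
  frobenius-+ x y = helper p ≡.refl
    where
    -- A generalized exponent can be matched as a successor. This separates the two end terms of the
    -- binomial sum from the middle ones, whose coefficients are divisible by `p`.
    helper : ∀ n → n ≡ p → (x + y) ^ n ≈ x ^ n + y ^ n
    helper zero ≡.refl = contradiction (ℕ.nonTrivial⇒n>1 0 {{prime⇒nonTrivial p-prime}}) (λ ())
    helper (suc n) eq = begin
      (x + y) ^ suc n
        ≈⟨ theorem (suc n) x y ⟩
      T zero + sum (T ∘ suc)
        ≈⟨ +-congˡ (sum-init-last (T ∘ suc)) ⟩
      T zero + (sum (λ i → T (suc (inject₁ i))) + T (suc (fromℕ n)))
        ≈⟨ +-cong T-zero (+-cong (trans (sum-cong-≋ T-middle) (sum-replicate-zero n)) T-last) ⟩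
      y ^ suc n + (0# + x ^ suc n)
        ≈⟨ trans (+-congˡ (+-identityˡ _)) (+-comm _ _) ⟩
      x ^ suc n + y ^ suc n ∎
      where
      T = binomialTerm x y (suc n)
      T-zero : T zero ≈ y ^ suc n
      T-zero = trans (+-identityʳ _) (*-identityˡ _)
      T-middle : ∀ i → T (suc (inject₁ i)) ≈ 0#
      T-middle i = ∣⇒×≈0 (≡.subst (λ m → p ∣ m C suc (toℕ (inject₁ i))) (≡.sym eq) (prime∣C p-prime ℕ.z<s
        (≡.subst₂ ℕ._<_ (≡.cong suc (≡.sym (toℕ-inject₁ i))) eq (ℕ.s<s (toℕ<n i))))) _
      T-last : T (suc (fromℕ n)) ≈ x ^ suc n
      T-last = begin
        (suc n C suc (toℕ (fromℕ n))) ×′ (x ^ suc (toℕ (fromℕ n)) * y ^ (suc n ∸ suc (toℕ (fromℕ n))))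
          ≡⟨ ≡.cong (λ k → (suc n C suc k) ×′ (x ^ suc k * y ^ (suc n ∸ suc k))) (toℕ-fromℕ n) ⟩
        (suc n C suc n) ×′ (x ^ suc n * y ^ (n ∸ n))
          ≡⟨ ≡.cong₂ (λ c k → c ×′ (x ^ suc n * y ^ k)) (nCn≡1 (suc n)) (ℕₚ.n∸n≡0 n) ⟩
        1 ×′ (x ^ suc n * 1#)
          ≈⟨ trans (+-identityʳ _) (*-identityʳ _) ⟩
        x ^ suc n ∎

  frobenius^-+ : ∀ e x y → (x + y) ^ (p ℕ.^ e) ≈ x ^ (p ℕ.^ e) + y ^ (p ℕ.^ e)
  frobenius^-+ zero    x y = trans (*-identityʳ _) (sym (+-cong (*-identityʳ x) (*-identityʳ y)))
  frobenius^-+ (suc e) x y = begin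
    (x + y) ^ (p ℕ.* p ℕ.^ e)                              ≈⟨ ^-assocʳ (x + y) p (p ℕ.^ e) ⟨
    ((x + y) ^ p) ^ (p ℕ.^ e)                              ≈⟨ ^-congˡ (p ℕ.^ e) (frobenius-+ x y) ⟩
    (x ^ p + y ^ p) ^ (p ℕ.^ e)                            ≈⟨ frobenius^-+ e (x ^ p) (y ^ p) ⟩
    (x ^ p) ^ (p ℕ.^ e) + (y ^ p) ^ (p ℕ.^ e)              ≈⟨ +-cong (^-assocʳ x p (p ℕ.^ e)) (^-assocʳ y p (p ℕ.^ e)) ⟩
    x ^ (p ℕ.^ suc e) + y ^ (p ℕ.^ suc e)                  ∎

-- Splitting X^q - X

module _ (B : Ring₀) where
  open CommutativeRing B

  linearProduct : ∀ {n} → Vec Carrier n → Carrier → Carrier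
  linearProduct []       x = 1#
  linearProduct (a ∷ as) x = (x - a) * linearProduct as x

  divide : ∀ {n} → Vec Carrier (suc n) → Carrier → Vec Carrier n
  divide (a ∷ [])    r = []
  divide (a ∷ b ∷ l) r = monic B (b ∷ l) r ∷ divide (b ∷ l) r

module _ {A B : Ring₀} (φ : Hom A B) where
  open CommutativeRing B hiding (zero)
  open RingHomomorphism φ
  open SetoidReasoning setoid
  private
    module A = CommutativeRing A
    module S = SemiringSolver commutativeSemiring

  Char-⟦⟧ : ∀ {p} → Char p A → Char p B
  Char-⟦⟧ {p} char = begin
    p B×.× 1#            ≈⟨ homo-× p ⟨
    ⟦ p A×.× A.1# ⟧      ≈⟨ ⟦⟧-cong char ⟩
    ⟦ A.0# ⟧             ≈⟨ 0#-homo ⟩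
    0#                   ∎
    where
    module A× = Mult A.semiring
    module B× = Mult semiring
    homo-× : ∀ n → ⟦ n A×.× A.1# ⟧ ≈ n B×.× 1#
    homo-× zero    = 0#-homo
    homo-× (suc n) = trans (+-homo _ _) (+-cong 1#-homo (homo-× n))

  -- Horner's scheme for the quotient by X - r.
  divide-correct : ∀ {n} (l : Vec A.Carrier (suc n)) r x →
    monic B (map ⟦_⟧ l) x ≈ (x - ⟦ r ⟧) * monic B (map ⟦_⟧ (divide A l r)) x + ⟦ monic A l r ⟧
  divide-correct (a ∷ l) r x = helper l
    where
    -- The solver works in commutative semirings and sees `- ⟦ r ⟧` as a variable. A vanishing
    -- summand `(⟦ r ⟧ - ⟦ r ⟧) * μ` is therefore inserted to balance the two sides.
    cancel-r : ∀ μ → (⟦ r ⟧ - ⟦ r ⟧) * μ ≈ 0#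
    cancel-r μ = trans (*-congʳ (-‿inverseʳ ⟦ r ⟧)) (zeroˡ μ)
    ⟦a+rμ⟧ : ∀ μ → ⟦ a A.+ r A.* μ ⟧ ≈ ⟦ a ⟧ + ⟦ r ⟧ * ⟦ μ ⟧
    ⟦a+rμ⟧ μ = trans (+-homo _ _) (+-congˡ (*-homo _ _))
    helper : ∀ {n} (l : Vec A.Carrier n) →
      ⟦ a ⟧ + x * monic B (map ⟦_⟧ l) x ≈
      (x - ⟦ r ⟧) * monic B (map ⟦_⟧ (divide A (a ∷ l) r)) x + ⟦ a A.+ r A.* monic A l r ⟧
    helper [] = begin
      ⟦ a ⟧ + x * 1#
        ≈⟨ +-identityʳ _ ⟨
      (⟦ a ⟧ + x * 1#) + 0#
        ≈⟨ +-congˡ (cancel-r 1#) ⟨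
      (⟦ a ⟧ + x * 1#) + (⟦ r ⟧ - ⟦ r ⟧) * 1#
        ≈⟨ S.solve 5 (λ a x r n e → (a S.:+ x S.:* e) S.:+ (r S.:+ n) S.:* e
                        S.:= (x S.:+ n) S.:* e S.:+ (a S.:+ r S.:* e)) refl ⟦ a ⟧ x ⟦ r ⟧ (- ⟦ r ⟧) 1# ⟩
      (x - ⟦ r ⟧) * 1# + (⟦ a ⟧ + ⟦ r ⟧ * 1#)
        ≈⟨ +-congˡ (trans (⟦a+rμ⟧ A.1#) (+-congˡ (*-congˡ 1#-homo))) ⟨
      (x - ⟦ r ⟧) * 1# + ⟦ a A.+ r A.* A.1# ⟧ ∎
    helper l@(_ ∷ _) = begin
      ⟦ a ⟧ + x * monic B (map ⟦_⟧ l) x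
        ≈⟨ +-congˡ (*-congˡ (divide-correct l r x)) ⟩
      ⟦ a ⟧ + x * ((x - ⟦ r ⟧) * Q + μ)
        ≈⟨ +-identityʳ _ ⟨
      (⟦ a ⟧ + x * ((x - ⟦ r ⟧) * Q + μ)) + 0#
        ≈⟨ +-congˡ (cancel-r μ) ⟨
      (⟦ a ⟧ + x * ((x - ⟦ r ⟧) * Q + μ)) + (⟦ r ⟧ - ⟦ r ⟧) * μ
        ≈⟨ S.solve 6 (λ a x r n Q μ → (a S.:+ x S.:* ((x S.:+ n) S.:* Q S.:+ μ)) S.:+ (r S.:+ n) S.:* μ
                        S.:= (x S.:+ n) S.:* (μ S.:+ x S.:* Q) S.:+ (a S.:+ r S.:* μ)) refl ⟦ a ⟧ x ⟦ r ⟧ (- ⟦ r ⟧) Q μ ⟩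
      (x - ⟦ r ⟧) * (μ + x * Q) + (⟦ a ⟧ + ⟦ r ⟧ * μ)
        ≈⟨ +-congˡ (⟦a+rμ⟧ (monic A l r)) ⟨
      (x - ⟦ r ⟧) * (μ + x * Q) + ⟦ a A.+ r A.* monic A l r ⟧ ∎
      where
      Q = monic B (map ⟦_⟧ (divide A l r)) x
      μ = ⟦ monic A l r ⟧

compose : ∀ {A B D : Ring₀} → Hom A B → Hom B D → Hom A D
compose {A} {B} {D} = Composition.ringHomomorphism
  {M₁ = CommutativeRing.ring A} {M₂ = CommutativeRing.ring B} {M₃ = CommutativeRing.ring D}

SplitsAt : ∀ {A B : Ring₀} → ℕ → Hom A B → ∀ {m n} →
           Vec (CommutativeRing.Carrier A) m → Vec (CommutativeRing.Carrier A) n →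
           CommutativeRing.Carrier B → Set
SplitsAt {B = B} q φ as l x = x ^ q - x ≈ linearProduct B (map ⟦_⟧ as) x * monic B (map ⟦_⟧ l) x
  where
  open CommutativeRing B
  open Exp semiring
  open RingHomomorphism φ

-- The polynomial identity X^q - X = (X - a₁) ⋯ (X - aₘ) · (monic of degree n), expressed by
-- its validity in all A-algebras.
record Splitting (q m n : ℕ) (A : Ring₀) : Set₁ where
  field
    roots    : Vec (CommutativeRing.Carrier A) m
    rest     : Vec (CommutativeRing.Carrier A) n
    identity : (B : Ring₀) (φ : Hom A B) → ∀ x → SplitsAt {A} {B} q φ roots rest x

-- Every algebra over `B` is an algebra over `A` along `φ`, so the identity over `A` already covers
-- it.
transport-splitting : ∀ {q m n A B} → Hom A B → Splitting q m n A → Splitting q m n B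
transport-splitting {q} {A = A} {B} φ 𝓢 = record
  { roots    = map φ.⟦_⟧ roots
  ; rest     = map φ.⟦_⟧ rest
  ; identity = identity′
  }
  where
  module φ = RingHomomorphism φ
  open Splitting 𝓢
  identity′ : (D : Ring₀) (ψ : Hom B D) → ∀ x →
              SplitsAt {B} {D} q ψ (map φ.⟦_⟧ roots) (map φ.⟦_⟧ rest) x
  identity′ D ψ x = ≡.subst₂ (λ as l → x ^ q - x ≈ linearProduct D as x * monic D l x)
    (map-∘ ⟦_⟧ φ.⟦_⟧ roots) (map-∘ ⟦_⟧ φ.⟦_⟧ rest) (identity D (compose {A} {B} {D} φ ψ) x)
    where
    open CommutativeRing D
    open Exp semiring
    open RingHomomorphism ψ

-- The exponent has the form `2 ℕ.+ q` so that -X lies strictly below the leading term and gets a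
-- coefficient of its own.
initial-splitting : ∀ q A → Splitting (2 ℕ.+ q) 0 (2 ℕ.+ q) A
initial-splitting q A = record
  { roots    = []
  ; rest     = coefficients
  ; identity = identity
  }
  where
  module A = CommutativeRing A
  coefficients : Vec A.Carrier (2 ℕ.+ q)
  coefficients = A.0# ∷ A.- A.1# ∷ replicate q A.0#
  module _ (B : Ring₀) (φ : Hom A B) where
    open CommutativeRing B hiding (zero)
    open Exp semiring
    open RingHomomorphism φ
    open RingProperties ring using (-1*x≈-x)
    open SetoidReasoning setoid
    monic-0 : ∀ n x → monic B (map ⟦_⟧ (replicate n A.0#)) x ≈ x ^ n
    monic-0 zero    x = refl
    monic-0 (suc n) x = trans (+-congʳ 0#-homo) (trans (+-identityˡ _) (*-congˡ (monic-0 n x)))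
    identity : ∀ x → SplitsAt {A} {B} (2 ℕ.+ q) φ [] coefficients x
    identity x = begin
      x * (x * x ^ q) - x
        ≈⟨ +-comm _ _ ⟩
      - x + x * (x * x ^ q)
        ≈⟨ +-cong (trans (*-comm _ _) (-1*x≈-x x)) (*-congˡ (*-congˡ (monic-0 q x))) ⟨
      x * - 1# + x * (x * M)
        ≈⟨ distribˡ x _ _ ⟨
      x * (- 1# + x * M)
        ≈⟨ *-congˡ (+-congʳ (trans (-‿homo A.1#) (-‿cong 1#-homo))) ⟨
      x * (⟦ A.- A.1# ⟧ + x * M)
        ≈⟨ trans (+-congʳ 0#-homo) (+-identityˡ _) ⟨
      ⟦ A.0# ⟧ + x * (⟦ A.- A.1# ⟧ + x * M)
        ≈⟨ *-identityˡ _ ⟨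
      1# * (⟦ A.0# ⟧ + x * (⟦ A.- A.1# ⟧ + x * M)) ∎
      where
      M = monic B (map ⟦_⟧ (replicate q A.0#)) x

split-off : ∀ {q m n A} (𝓢 : Splitting q m (suc n) A) → ∀ r →
            CommutativeRing._≈_ A (monic A (Splitting.rest 𝓢) r) (CommutativeRing.0# A) →
            Splitting q (suc m) n A
split-off {q} {A = A} 𝓢 r r-root = record
  { roots    = r ∷ roots
  ; rest     = divide A rest r
  ; identity = identity′
  }
  where
  open Splitting 𝓢
  identity′ : (B : Ring₀) (φ : Hom A B) → ∀ x → SplitsAt {A} {B} q φ (r ∷ roots) (divide A rest r) x
  identity′ B φ x = begin
    x ^ q - x
      ≈⟨ identity B φ x ⟩
    Π * monic B (map ⟦_⟧ rest) x
      ≈⟨ *-congˡ (divide-correct {A} {B} φ rest r x) ⟩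
    Π * ((x - ⟦ r ⟧) * Q + ⟦ monic A rest r ⟧)
      ≈⟨ *-congˡ (trans (+-congˡ (trans (⟦⟧-cong r-root) 0#-homo)) (+-identityʳ _)) ⟩
    Π * ((x - ⟦ r ⟧) * Q)
      ≈⟨ S.solve 3 (λ a b c → a S.:* (b S.:* c) S.:= (b S.:* a) S.:* c) refl _ _ _ ⟩
    (x - ⟦ r ⟧) * Π * Q ∎
    where
    open CommutativeRing B
    open Exp semiring
    open RingHomomorphism φ
    open SetoidReasoning setoid
    module S = SemiringSolver commutativeSemiring
    Π = linearProduct B (map ⟦_⟧ roots) x
    Q = monic B (map ⟦_⟧ (divide A rest r)) x

-- Extensions of the integers modulo p

module ℤ/ (p : ℕ) where
  private ℤ-ring = ℤₚ.+-*-commutativeRing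
  open Quotient ℤ-ring (ℤ.+ p) public
  open CommutativeRing quotient using (0#; 1#; semiring)

  char : Char p quotient
  char = ≡.subst (_~ 0#) (≡.sym (p×1 p)) r~0
    where
    open Mult semiring renaming (_×_ to _×′_)
    p×1 : ∀ n → n ×′ 1# ≡ ℤ.+ n
    p×1 zero    = ≡.refl
    p×1 (suc n) = ≡.cong (λ z → 1# ℤ.+ z) (p×1 n)

  nontrivial : 1 ℕ.< p → Nontrivial quotient
  nontrivial 1<p (h , 1≡) = ℕₚ.<⇒≱ 1<p (∣⇒≤ (divides ℤ.∣ h ∣ (begin
    1                        ≡⟨ ≡.cong ℤ.∣_∣ (≡.trans 1≡ (ℤₚ.+-identityˡ (ℤ.+ p ℤ.* h))) ⟩
    ℤ.∣ ℤ.+ p ℤ.* h ∣        ≡⟨ ℤₚ.abs-* (ℤ.+ p) h ⟩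
    p ℕ.* ℤ.∣ h ∣            ≡⟨ ℕₚ.*-comm p ℤ.∣ h ∣ ⟩
    ℤ.∣ h ∣ ℕ.* p            ∎)))
    where open ≡.≡-Reasoning

  cover : .{{_ : ℕ.NonZero p}} → Cover p quotient
  cover = (λ i → ℤ.+ toℕ i) , λ x → fromℕ< (ℤ.n%ℕd<d x p) , x ℤ./ℕ p , (begin
    x
      ≡⟨ ℤ.a≡a%ℕn+[a/ℕn]*n x p ⟩
    ℤ.+ (x ℤ.%ℕ p) ℤ.+ (x ℤ./ℕ p) ℤ.* ℤ.+ p
      ≡⟨ ≡.cong₂ (λ r z → ℤ.+ r ℤ.+ z) (≡.sym (toℕ-fromℕ< (ℤ.n%ℕd<d x p))) (ℤₚ.*-comm (x ℤ./ℕ p) (ℤ.+ p)) ⟩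
    ℤ.+ toℕ (fromℕ< (ℤ.n%ℕd<d x p)) ℤ.+ ℤ.+ p ℤ.* (x ℤ./ℕ p) ∎)
    where open ≡.≡-Reasoning

-- Here `m` roots have been found and a factor of degree `n` is left. These data pass both to the
-- adjunction of a further root and to nontrivial quotients.
record Stage (p q m n N : ℕ) : Set₁ where
  field
    ring       : Ring₀
    nontrivial : Nontrivial ring
    cover      : Cover N ring
    char       : Char p ring
    splitting  : Splitting q m n ring

adjoin-root : ∀ {p q m n N} → Stage p q m (suc n) N → Stage p q (suc m) n (N ℕ.^ suc n)
adjoin-root {p} {q} {m} {n} stage = record
  { ring       = extension
  ; nontrivial = extension-nontrivial rest nontrivial
  ; cover      = extension-cover rest cover
  ; char       = Char-⟦⟧ {ring} {extension} conHom {p} char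
  ; splitting  = split-off (transport-splitting {q} {m} {suc n} {ring} {extension} conHom splitting) X (X-root rest)
  }
  where
  open Stage stage
  open Splitting splitting
  open Extension ring
  open Adjoin (monicTerm rest)

adjoin-roots : ∀ {p q m} n {N} → Stage p q m n N → ∃ λ N′ → Stage p q (n ℕ.+ m) 0 N′
adjoin-roots zero    stage = _ , stage
adjoin-roots {p} {q} {m} (suc n) stage =
  ≡.subst (λ k → ∃ λ N′ → Stage p q k 0 N′) (ℕₚ.+-suc n m) (adjoin-roots n (adjoin-root stage))

splitting-ring : ∀ {p q} → Prime p → 2 ℕ.≤ q → ∃ λ N → Stage p q q 0 N
splitting-ring {p} {suc (suc q)} p-prime (ℕ.s≤s (ℕ.s≤s _)) =
  ≡.subst (λ k → ∃ λ N → Stage p (2 ℕ.+ q) k 0 N) (ℕₚ.+-identityʳ (2 ℕ.+ q)) (adjoin-roots (2 ℕ.+ q) (record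
    { ring       = quotient
    ; nontrivial = nontrivial (ℕ.nonTrivial⇒n>1 p {{prime⇒nonTrivial p-prime}})
    ; cover      = cover {{prime⇒nonZero p-prime}}
    ; char       = char
    ; splitting  = initial-splitting q quotient
    }))
  where open ℤ/ p

-- Rings with a smallest cover

-- `P` is not assumed decidable, so the least number principle is stated under a double negation.
¬¬-least : ∀ {P : ℕ → Set₁} {n} → P n → ¬ ¬ ∃ λ m → P m × (∀ {k} → k ℕ.< m → ¬ P k)
¬¬-least {P} {n} Pn none = <-rec (λ m → ¬ P m) (λ m below Pm → none (m , Pm , below)) n Pn

ZeroOrUnit : (A : Ring₀) → CommutativeRing.Carrier A → Set
ZeroOrUnit A x = x ≈ 0# ⊎ ∃ λ y → x * y ≈ 1#
  where open CommutativeRing A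

-- If x were neither zero nor a unit, the quotient by x would have a smaller cover.
minimal⇒zero-or-unit : ∀ {p q m n N} (stage : Stage p q m n N) → (∀ {k} → k ℕ.< N → ¬ Stage p q m n k) →
                       ∀ x → ¬ ¬ ZeroOrUnit (Stage.ring stage) x
minimal⇒zero-or-unit {N = zero} stage _ x with proj₂ (Stage.cover stage) x
... | () , _
minimal⇒zero-or-unit {p} {q} {m} {n} {N = suc N} stage minimal x neither = minimal (ℕₚ.n<1+n N) (record
  { ring       = quotient
  ; nontrivial = λ (h , 1≈) → neither (inj₂ (h , sym (trans 1≈ (+-identityˡ (x * h)))))
  -- The representative of `x` is dropped: modulo `x` its class is that of `0#`, which by `i₀≢j₀`
  -- has another representative.
  ; cover      = e ∘ punchIn i₀ , covers′
  ; char       = Char-⟦⟧ {ring} {quotient} π {p} char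
  ; splitting  = transport-splitting {q} {m} {n} {ring} {quotient} π splitting
  })
  where
  open Stage stage
  open CommutativeRing ring hiding (ring; zero)
  open Quotient ring x
  module Q = CommutativeRing quotient
  e  = proj₁ cover
  i₀ = proj₁ (proj₂ cover x)
  j₀ = proj₁ (proj₂ cover 0#)
  x≈ : x ≈ e i₀
  x≈ = proj₂ (proj₂ cover x)
  0≈ : 0# ≈ e j₀
  0≈ = proj₂ (proj₂ cover 0#)
  i₀≢j₀ : i₀ ≢ j₀
  i₀≢j₀ eq = neither (inj₁ (trans x≈ (trans (reflexive (≡.cong e eq)) (sym 0≈))))
  reindex : ∀ {z i} (i₀≢i : i₀ ≢ i) → z ≈ e i → z ~ e (punchIn i₀ (punchOut i₀≢i))
  reindex i₀≢i z≈ = ≈⇒~ (trans z≈ (reflexive (≡.cong e (≡.sym (punchIn-punchOut i₀≢i)))))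
  covers′ : ∀ z → ∃ λ i → z ~ e (punchIn i₀ i)
  covers′ z with proj₂ cover z
  ... | i , z≈ with i₀ Fin.≟ i
  ... | no i₀≢i    = punchOut i₀≢i , reindex i₀≢i z≈
  ... | yes ≡.refl = punchOut i₀≢j₀ ,
    Q.trans (≈⇒~ (trans z≈ (sym x≈))) (Q.trans r~0 (reindex i₀≢j₀ 0≈))

module _ (B : Ring₀) where
  open CommutativeRing B hiding (zero)
  open AbelianGroupProperties +-abelianGroup using () renaming (x∙y⁻¹≈ε⇒x≈y to x-y≈0⇒x≈y)
  private module S = SemiringSolver commutativeSemiring

  linearProduct-factor : ∀ {n} (as : Vec Carrier n) i x →
                         ∃ λ h → linearProduct B as x ≈ (x - lookup as i) * h
  linearProduct-factor (a ∷ as) zero    x = linearProduct B as x , refl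
  linearProduct-factor (a ∷ as) (suc i) x with linearProduct-factor as i x
  ... | h , eq = (x - a) * h , trans (*-congˡ eq)
    (S.solve 3 (λ a b c → a S.:* (b S.:* c) S.:= b S.:* (a S.:* c)) refl (x - a) _ h)

  -- At two indices with the same root this exhibits a squared factor, as needed to exclude multiple
  -- roots.
  linearProduct-factor₂ : ∀ {n} (as : Vec Carrier n) {i j} → i ≢ j → ∀ x →
                          ∃ λ h → linearProduct B as x ≈ (x - lookup as i) * ((x - lookup as j) * h)
  linearProduct-factor₂ (a ∷ as) {zero}  {zero}  i≢j x = contradiction ≡.refl i≢j
  linearProduct-factor₂ (a ∷ as) {zero}  {suc j} i≢j x with linearProduct-factor as j x
  ... | h , eq = h , *-congˡ eq
  linearProduct-factor₂ (a ∷ as) {suc i} {zero}  i≢j x with linearProduct-factor as i x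
  ... | h , eq = h , trans (*-congˡ eq)
    (S.solve 3 (λ a b c → a S.:* (b S.:* c) S.:= b S.:* (a S.:* c)) refl (x - a) _ h)
  linearProduct-factor₂ (a ∷ as) {suc i} {suc j} i≢j x with linearProduct-factor₂ as (i≢j ∘ ≡.cong suc) x
  ... | h , eq = (x - a) * h , trans (*-congˡ eq)
    (S.solve 4 (λ a b c h → a S.:* (b S.:* (c S.:* h)) S.:= b S.:* (c S.:* (a S.:* h))) refl (x - a) _ _ h)

  linearProduct-root : ∀ {n} (as : Vec Carrier n) i → linearProduct B as (lookup as i) ≈ 0#
  linearProduct-root as i with linearProduct-factor as i (lookup as i)
  ... | h , eq = trans eq (trans (*-congʳ (-‿inverseʳ (lookup as i))) (zeroˡ h))

  module _ (zero-or-unit : ∀ x → ZeroOrUnit B x) where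

    *-zero : ∀ x y → x * y ≈ 0# → x ≈ 0# ⊎ y ≈ 0#
    *-zero x y xy≈0 with zero-or-unit x
    ... | inj₁ x≈0 = inj₁ x≈0
    ... | inj₂ (w , xw≈1) = inj₂ (begin
      y              ≈⟨ *-identityˡ y ⟨
      1# * y         ≈⟨ *-congʳ xw≈1 ⟨
      (x * w) * y    ≈⟨ S.solve 3 (λ x w y → (x S.:* w) S.:* y S.:= w S.:* (x S.:* y)) refl x w y ⟩
      w * (x * y)    ≈⟨ *-congˡ xy≈0 ⟩
      w * 0#         ≈⟨ zeroʳ w ⟩
      0#             ∎)
      where open SetoidReasoning setoid

    linearProduct-zero : Nontrivial B → ∀ {n} (as : Vec Carrier n) x → linearProduct B as x ≈ 0# →
                         ∃ λ i → x ≈ lookup as i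
    linearProduct-zero 1≉0 []       x eq = contradiction eq 1≉0
    linearProduct-zero 1≉0 (a ∷ as) x eq with *-zero (x - a) _ eq
    ... | inj₁ x-a≈0 = zero , x-y≈0⇒x≈y x a x-a≈0
    ... | inj₂ rest≈0 with linearProduct-zero 1≉0 as x rest≈0
    ... | i , x≈ = suc i , x≈

2≤p^e : ∀ {p e} → Prime p → 1 ℕ.≤ e → 2 ℕ.≤ p ℕ.^ e
2≤p^e {p} {e} p-prime 1≤e = ℕₚ.≤-trans (ℕ.nonTrivial⇒n>1 p {{prime⇒nonTrivial p-prime}})
  (≡.subst (ℕ._≤ p ℕ.^ e) (ℕₚ.*-identityʳ p) (ℕₚ.^-monoʳ-≤ p {{prime⇒nonZero p-prime}} 1≤e))

-- Orthogonal families from the roots of X^q - X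

injective⇒hits : ∀ {n} (f : Fin n → Fin n) → Injective _≡_ _≡_ f → ∀ c → ∃ λ x → f x ≡ c
injective⇒hits {suc n} f inj c with any? (λ x → f x Fin.≟ c)
... | yes hit = hit
... | no miss = contradiction (injective⇒≤ punched-injective) ℕₚ.1+n≰n
  where
  avoids : ∀ x → c ≢ f x
  avoids x eq = miss (x , ≡.sym eq)
  punched-injective : Injective _≡_ _≡_ (λ x → punchOut (avoids x))
  punched-injective eq = inj (punchOut-injective (avoids _) (avoids _) eq)

-- With y, the maps F i form an orthogonal array of strength two.
record OrthogonalFamily (m w : ℕ) : Set where
  field
    F          : Fin m → Fin w → Fin w → Fin w
    cancel     : ∀ i y {x x′} → F i x y ≡ F i x′ y → x ≡ x′
    orthogonal : ∀ {i j} → i ≢ j → ∀ {x x′ y y′} →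
                 F i x y ≡ F i x′ y′ → F j x y ≡ F j x′ y′ → y ≡ y′

  solve : ∀ i y c → ∃ λ x → F i x y ≡ c
  solve i y = injective⇒hits (λ x → F i x y) (cancel i y)

module SplitRoots {p e : ℕ} (p-prime : Prime p) (1≤e : 1 ℕ.≤ e) {A : Ring₀} (char : Char p A)
                  (𝓢 : Splitting (p ℕ.^ e) (p ℕ.^ e) 0 A) where
  open Splitting 𝓢
  private
    module A = CommutativeRing A
    q = p ℕ.^ e

  root : Fin q → A.Carrier
  root = lookup roots

  module _ {B : Ring₀} (φ : Hom A B) where
    open CommutativeRing B hiding (zero)
    open Exp semiring
    open RingHomomorphism φ
    open SetoidReasoning setoid
    open AbelianGroupProperties +-abelianGroup using (⁻¹-involutive; ε⁻¹≈ε; ⁻¹-∙-comm)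
      renaming (x∙y⁻¹≈ε⇒x≈y to x-y≈0⇒x≈y)

    identity′ : ∀ x → x ^ q - x ≈ linearProduct B (map ⟦_⟧ roots) x
    identity′ x = trans (identity B φ x) (trans (*-congˡ (monic[] rest)) (*-identityʳ _))
      where
      monic[] : ∀ (l : Vec A.Carrier 0) → monic B (map ⟦_⟧ l) x ≈ 1#
      monic[] [] = refl

    root^q : ∀ i → ⟦ root i ⟧ ^ q ≈ ⟦ root i ⟧
    root^q i = x-y≈0⇒x≈y _ _ (trans (identity′ ⟦ root i ⟧)
      (≡.subst (λ x → linearProduct B (map ⟦_⟧ roots) x ≈ 0#) (lookup-map i ⟦_⟧ roots)
        (linearProduct-root B (map ⟦_⟧ roots) i)))

    -- Evaluate the splitting at aᵢ + ε, where the left-hand side has derivative -1.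
    double-root : ∀ {i j} → i ≢ j → root i A.≈ root j → ∀ ε → ε * ε ≈ 0# → ε ≈ 0#
    double-root {i} {j} i≢j aᵢ≈aⱼ ε ε²≈0 with linearProduct-factor₂ B (map ⟦_⟧ roots) i≢j (⟦ root i ⟧ + ε)
    ... | h , eq = begin
      ε                              ≈⟨ ⁻¹-involutive ε ⟨
      - (- ε)                        ≈⟨ -‿cong -ε≈0 ⟩
      - 0#                           ≈⟨ ε⁻¹≈ε ⟩
      0#                             ∎
      where
      module S = SemiringSolver commutativeSemiring
      a = ⟦ root i ⟧
      ^-zero : ∀ n → 2 ℕ.≤ n → ε ^ n ≈ 0#
      ^-zero (suc (suc n)) (ℕ.s≤s (ℕ.s≤s _)) = trans (sym (*-assoc ε ε (ε ^ n))) (trans (*-congʳ ε²≈0) (zeroˡ _))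
      shifted : ∀ k → ⟦ root i ⟧ ≈ ⟦ root k ⟧ → (a + ε) - lookup (map ⟦_⟧ roots) k ≈ ε
      shifted k a≈ = begin
        (a + ε) - lookup (map ⟦_⟧ roots) k   ≈⟨ +-congˡ (-‿cong (trans (reflexive (lookup-map k ⟦_⟧ roots)) (sym a≈))) ⟩
        (a + ε) - a                          ≈⟨ S.solve 3 (λ a ε n → (a S.:+ ε) S.:+ n S.:= ε S.:+ (a S.:+ n)) refl a ε (- a) ⟩
        ε + (a - a)                          ≈⟨ +-congˡ (-‿inverseʳ a) ⟩
        ε + 0#                               ≈⟨ +-identityʳ ε ⟩
        ε                                    ∎
      -ε≈0 : - ε ≈ 0#
      -ε≈0 = begin
        - ε                                  ≈⟨ +-identityˡ (- ε) ⟨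
        0# - ε                               ≈⟨ +-congʳ (-‿inverseʳ a) ⟨
        (a - a) - ε                          ≈⟨ +-assoc a (- a) (- ε) ⟩
        a + (- a - ε)                        ≈⟨ +-cong (sym (trans (+-identityʳ _) (root^q i))) (⁻¹-∙-comm a ε) ⟩
        (a ^ q + 0#) - (a + ε)               ≈⟨ +-congʳ (+-congˡ (^-zero q (2≤p^e p-prime 1≤e))) ⟨
        (a ^ q + ε ^ q) - (a + ε)            ≈⟨ +-congʳ (frobenius^-+ e a ε) ⟨
        (a + ε) ^ q - (a + ε)                ≈⟨ identity′ (a + ε) ⟩
        linearProduct B (map ⟦_⟧ roots) (a + ε) ≈⟨ eq ⟩
        _                                    ≈⟨ *-cong (shifted i refl) (*-congʳ (shifted j (⟦⟧-cong aᵢ≈aⱼ))) ⟩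
        ε * (ε * h)                          ≈⟨ *-assoc ε ε h ⟨
        (ε * ε) * h                          ≈⟨ *-congʳ ε²≈0 ⟩
        0# * h                               ≈⟨ zeroˡ h ⟩
        0#                                   ∎
        where open Frobenius B p-prime (Char-⟦⟧ {A} {B} φ {p} char)

  -- Separability of X^q - X. The dual numbers over `A` arise by adjoining an `X` with square zero;
  -- if two roots coincided, `double-root` would make this `X` vanish.
  root-injective : Nontrivial A → ∀ {i j} → root i A.≈ root j → i ≡ j
  root-injective 1≉0 {i} {j} aᵢ≈aⱼ with i Fin.≟ j
  ... | yes i≡j = i≡j
  ... | no i≢j = contradiction (A.trans (at X≋0 s (λ _ → A.refl) 0) (A.zeroˡ _)) 1≉0
    where
    open Extension A
    open Adjoin (X ⊗ X)
    -- The sequence 0, 1, 0, 0, ... is annihilated by the double shift, while a single shift moves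
    -- its 1 to index 0, where it contradicts the vanishing of `X`.
    s : Seq
    s 1 = A.1#
    s _ = A.0#
    X≋0 : X ≋ con A.0#
    X≋0 = double-root {extension} conHom i≢j aᵢ≈aⱼ X F≋0

  module _ (1≉0 : Nontrivial A) (zero-or-unit : ∀ x → ZeroOrUnit A x) where
    open CommutativeRing A hiding (zero)
    open SetoidReasoning setoid
    open RingProperties ring using (x[y-z]≈xy-xz)
    open AbelianGroupProperties +-abelianGroup using (∙-cancelʳ)
      renaming (x∙y⁻¹≈ε⇒x≈y to x-y≈0⇒x≈y; x≈y⇒x∙y⁻¹≈ε to x≈y⇒x-y≈0)
    private
      module S = SemiringSolver commutativeSemiring
      open Exp semiring
      open CommutativeExp commutativeSemiring using (^-distrib-*)
      open Frobenius A p-prime char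

      identityHom : Hom A A
      identityHom = mkHom {A} {A} id id (λ _ _ → refl) refl (λ _ _ → refl) refl (λ _ → refl)

      root^q′ : ∀ i → root i ^ q ≈ root i
      root^q′ = root^q {A} identityHom

    -- The roots are fixed by the map sending x to x^q. This map is additive and multiplicative, so
    -- the combination is fixed as well and annihilates the product of linear factors. Since every
    -- element is zero or a unit, one factor vanishes.
    closed : ∀ m i j → ∃ λ k → root i + root m * root j ≈ root k
    closed m i j = linearProduct-zero A zero-or-unit 1≉0 roots y
      (≡.subst (λ as → linearProduct A as y ≈ 0#) (map-id roots)
        (trans (sym (identity′ {A} identityHom y)) (x≈y⇒x-y≈0 y^q≈y)))
      where
      y = root i + root m * root j
      y^q≈y : y ^ q ≈ y
      y^q≈y = begin
        y ^ q                                     ≈⟨ frobenius^-+ e (root i) (root m * root j) ⟩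
        root i ^ q + (root m * root j) ^ q        ≈⟨ +-cong (root^q′ i) (trans (^-distrib-* (root m) (root j) q)
                                                       (*-cong (root^q′ m) (root^q′ j))) ⟩
        y                                         ∎

    -- Subtracting the two equations gives (m - n)(y - y′) = 0. For the sake of the semiring solver,
    -- `scaled` instead adds the same terms to both sides, applies the hypotheses and cancels.
    orthogonal-root : ∀ {m n x x′ y y′} → ¬ (m ≈ n) → x + m * y ≈ x′ + m * y′ → x + n * y ≈ x′ + n * y′ → y ≈ y′
    orthogonal-root {m} {n} {x} {x′} {y} {y′} m≉n eqₘ eqₙ
      with *-zero A zero-or-unit (m - n) (y - y′) (trans (x[y-z]≈xy-xz _ _ _) (x≈y⇒x-y≈0 scaled))
      where
      n-n≈0 : ∀ z → (n - n) * z ≈ 0#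
      n-n≈0 z = trans (*-congʳ (-‿inverseʳ n)) (zeroˡ z)
      scaled : (m - n) * y ≈ (m - n) * y′
      scaled = ∙-cancelʳ (x + x′) _ _ (∙-cancelʳ (n * y + n * y′) _ _ (begin
        ((m - n) * y + (x + x′)) + (n * y + n * y′)
          ≈⟨ S.solve 7 (λ m n k x x′ y y′ → ((m S.:+ k) S.:* y S.:+ (x S.:+ x′)) S.:+ (n S.:* y S.:+ n S.:* y′)
               S.:= ((x S.:+ m S.:* y) S.:+ (x′ S.:+ n S.:* y′)) S.:+ (n S.:+ k) S.:* y) refl m n (- n) x x′ y y′ ⟩
        ((x + m * y) + (x′ + n * y′)) + (n - n) * y
          ≈⟨ +-cong (+-cong eqₘ (sym eqₙ)) (trans (n-n≈0 y) (sym (n-n≈0 y′))) ⟩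
        ((x′ + m * y′) + (x + n * y)) + (n - n) * y′
          ≈⟨ S.solve 7 (λ m n k x x′ y y′ → ((x′ S.:+ m S.:* y′) S.:+ (x S.:+ n S.:* y)) S.:+ (n S.:+ k) S.:* y′
               S.:= ((m S.:+ k) S.:* y′ S.:+ (x S.:+ x′)) S.:+ (n S.:* y S.:+ n S.:* y′)) refl m n (- n) x x′ y y′ ⟩
        ((m - n) * y′ + (x + x′)) + (n * y + n * y′) ∎))
    ... | inj₁ m-n≈0 = contradiction (x-y≈0⇒x≈y m n m-n≈0) m≉n
    ... | inj₂ y-y′≈0 = x-y≈0⇒x≈y y y′ y-y′≈0

    rootFamily : OrthogonalFamily q q
    rootFamily = record
      { F          = λ m i j → proj₁ (closed m i j)
      ; cancel     = λ m j eq → root-injective 1≉0 (∙-cancelʳ _ _ _ (sums m eq))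
      ; orthogonal = λ {m} {n} m≢n eqₘ eqₙ → root-injective 1≉0
          (orthogonal-root (m≢n ∘ root-injective 1≉0) (sums m eqₘ) (sums n eqₙ))
      }
      where
      sums : ∀ m {i i′ j j′} → proj₁ (closed m i j) ≡ proj₁ (closed m i′ j′) →
             root i + root m * root j ≈ root i′ + root m * root j′
      sums m {i} {i′} {j} {j′} eq = trans (proj₂ (closed m i j))
        (trans (reflexive (≡.cong root eq)) (sym (proj₂ (closed m i′ j′))))

-- The existence of a family is a finite search, so it may be proved by contradiction.
family-stable : ∀ {m w} → ¬ ¬ OrthogonalFamily m w → OrthogonalFamily m w
family-stable {m} {w} ¬¬family = decode (decidable-stable (any? valid?) (¬¬-map encode ¬¬family))
  where
  -- All functions of a triple with values in `Fin w` are numbered, so that `any?` can search them.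
  Code = Fin (w ℕ.^ (m ℕ.* (w ℕ.* w)))

  at : Code → Fin m → Fin w → Fin w → Fin w
  at c i x y = finToFun c (combine i (combine x y))

  Valid : Code → Set
  Valid c = (∀ i y x x′ → at c i x y ≡ at c i x′ y → x ≡ x′) ×
            (∀ i j → i ≢ j → ∀ x x′ y y′ → at c i x y ≡ at c i x′ y′ → at c j x y ≡ at c j x′ y′ → y ≡ y′)

  valid? : ∀ c → Dec (Valid c)
  valid? c =
    (all? λ i → all? λ y → all? λ x → all? λ x′ → (at c i x y Fin.≟ at c i x′ y) →-dec (x Fin.≟ x′)) ×-dec
    (all? λ i → all? λ j → ¬? (i Fin.≟ j) →-dec (all? λ x → all? λ x′ → all? λ y → all? λ y′ →
      (at c i x y Fin.≟ at c i x′ y′) →-dec ((at c j x y Fin.≟ at c j x′ y′) →-dec (y Fin.≟ y′))))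

  decode : ∃ Valid → OrthogonalFamily m w
  decode (c , cancel , orthogonal) = record
    { F          = at c
    ; cancel     = λ i y → cancel i y _ _
    ; orthogonal = λ i≢j → orthogonal _ _ i≢j _ _ _ _
    }

  encode : OrthogonalFamily m w → ∃ Valid
  encode 𝓕 = c ,
    (λ i y x x′ eq → cancel i y (transfer i eq)) ,
    (λ i j i≢j x x′ y y′ eqᵢ eqⱼ → orthogonal i≢j (transfer i eqᵢ) (transfer j eqⱼ))
    where
    open OrthogonalFamily 𝓕
    table : Fin (m ℕ.* (w ℕ.* w)) → Fin w
    table k = let i , k′ = remQuot {m} (w ℕ.* w) k in
              F i (proj₁ (remQuot {w} w k′)) (proj₂ (remQuot {w} w k′))
    c : Code
    c = funToFin table
    at-c : ∀ i x y → at c i x y ≡ F i x y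
    at-c i x y = begin
      finToFun c (combine i (combine x y))      ≡⟨ finToFun-funToFin table _ ⟩
      table (combine i (combine x y))           ≡⟨ ≡.cong (λ (i , k) → F i (proj₁ (remQuot {w} w k)) (proj₂ (remQuot {w} w k)))
                                                     (remQuot-combine i (combine x y)) ⟩
      F i (proj₁ (remQuot {w} w (combine x y))) (proj₂ (remQuot {w} w (combine x y)))
                                                ≡⟨ ≡.cong (λ (x , y) → F i x y) (remQuot-combine x y) ⟩
      F i x y                                   ∎
      where open ≡.≡-Reasoning
    transfer : ∀ i {x x′ y y′} → at c i x y ≡ at c i x′ y′ → F i x y ≡ F i x′ y′
    transfer i {x} {x′} {y} {y′} eq = ≡.trans (≡.sym (at-c i x y)) (≡.trans eq (at-c i x′ y′))

primePowerFamily : ∀ {p e} → Prime p → 1 ℕ.≤ e → OrthogonalFamily (p ℕ.^ e) (p ℕ.^ e)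
primePowerFamily {p} {e} p-prime 1≤e = family-stable λ no-family →
  ¬¬-least {P = Stage p q q 0} (proj₂ (splitting-ring p-prime (2≤p^e p-prime 1≤e))) λ (N , stage , minimal) →
  -- Each representative is zero or a unit only up to double negation. There are finitely many of
  -- them, so the double negation moves outside the quantifier; `extend` then passes to all
  -- elements.
  sequence (RawMonad.rawApplicative ¬¬-Monad)
    (λ i → minimal⇒zero-or-unit stage minimal (proj₁ (cover stage) i)) λ zero-or-unit →
  no-family (SplitRoots.rootFamily {p} {e} p-prime 1≤e (char stage) (splitting stage) (nontrivial stage)
    (extend (ring stage) (cover stage) zero-or-unit))
  where
  open Stage
  q = p ℕ.^ e

  extend : ∀ {N} (A : Ring₀) (cover : Cover N A) → (∀ i → ZeroOrUnit A (proj₁ cover i)) → ∀ x → ZeroOrUnit A x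
  extend A (_ , covers) zero-or-unit x with covers x
  ... | i , x≈ with zero-or-unit i
  ... | inj₁ ≈0       = inj₁ (CommutativeRing.trans A x≈ ≈0)
  ... | inj₂ (y , ≈1) = inj₂ (y , CommutativeRing.trans A (CommutativeRing.*-congʳ A x≈) ≈1)

-- Detecting arrays from orthogonal families

open import Data.Nat using (_+_; _*_; _^_)
open ≡ using (refl; sym; trans; cong; cong₂; subst; module ≡-Reasoning)

-- Direct products of orthogonal families

restrict : ∀ {m n w} → m ≤ n → OrthogonalFamily n w → OrthogonalFamily m w
restrict m≤n 𝓕 = record
  { F          = λ i → F (inject≤ i m≤n)
  ; cancel     = λ i → cancel (inject≤ i m≤n)
  ; orthogonal = λ i≢j → orthogonal (i≢j ∘ inject≤-injective m≤n m≤n _ _)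
  }
  where open OrthogonalFamily 𝓕

trivialFamily : ∀ {m} → OrthogonalFamily m 1
trivialFamily = record
  { F          = λ _ x _ → x
  ; cancel     = λ _ _ eq → eq
  ; orthogonal = λ { _ {y = zero} {y′ = zero} _ _ → refl }
  }

module _ {m v w : ℕ} (𝓕 : OrthogonalFamily m v) (𝓖 : OrthogonalFamily m w) where
  private
    module 𝓕 = OrthogonalFamily 𝓕
    module 𝓖 = OrthogonalFamily 𝓖

    fst : Fin (v * w) → Fin v
    fst x = proj₁ (remQuot {v} w x)
    snd : Fin (v * w) → Fin w
    snd x = proj₂ (remQuot {v} w x)

    remQuot-injective : ∀ {x y} → fst x ≡ fst y → snd x ≡ snd y → x ≡ y
    remQuot-injective {x} {y} eq₁ eq₂ =
      trans (sym (combine-remQuot {v} w x)) (trans (cong₂ combine eq₁ eq₂) (combine-remQuot {v} w y))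

    H : Fin m → Fin (v * w) → Fin (v * w) → Fin (v * w)
    H i x y = combine (𝓕.F i (fst x) (fst y)) (𝓖.F i (snd x) (snd y))

    components : ∀ i {x x′ y y′} → H i x y ≡ H i x′ y′ →
                 𝓕.F i (fst x) (fst y) ≡ 𝓕.F i (fst x′) (fst y′) ×
                 𝓖.F i (snd x) (snd y) ≡ 𝓖.F i (snd x′) (snd y′)
    components i = combine-injective _ _ _ _

  -- MacNeish's direct product: equality of two symbols splits into equalities of their components,
  -- and the same indices `i` and `j` serve in both factors.
  productFamily : OrthogonalFamily m (v * w)
  productFamily = record
    { F          = H
    ; cancel     = λ i y eq → let eq₁ , eq₂ = components i {y = y} {y} eq in
                   remQuot-injective (𝓕.cancel i _ eq₁) (𝓖.cancel i _ eq₂)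
    ; orthogonal = λ {i} {j} i≢j {x} {x′} {y} {y′} eqᵢ eqⱼ →
                   let eqᵢ₁ , eqᵢ₂ = components i {x} {x′} {y} {y′} eqᵢ
                       eqⱼ₁ , eqⱼ₂ = components j {x} {x′} {y} {y′} eqⱼ in
                   remQuot-injective (𝓕.orthogonal i≢j eqᵢ₁ eqⱼ₁) (𝓖.orthogonal i≢j eqᵢ₂ eqⱼ₂)
    }

foldr-productFamily : ∀ {m s} (q : Fin s → ℕ) → (∀ i → OrthogonalFamily m (q i)) →
                      OrthogonalFamily m (foldr _*_ 1 q)
foldr-productFamily {s = zero}  q 𝓕 = trivialFamily
foldr-productFamily {s = suc s} q 𝓕 =
  productFamily (𝓕 zero) (foldr-productFamily (q ∘ suc) (𝓕 ∘ suc))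

-- Residues modulo t

module _ (t′ : ℕ) where
  private t = suc t′

  residue : ℕ → Fin t → Fin t
  residue i j = fromℕ< (m%n<n (i + toℕ j) t)

  -- The map r ↦ r - i modulo t, written without subtraction since t′ ≡ -1.
  unresidue : ℕ → Fin t → Fin t
  unresidue i r = fromℕ< (m%n<n (i * t′ + toℕ r) t)

  private
    +-% : ∀ m n → (m + n % t) % t ≡ (m + n) % t
    +-% m n = begin
      (m + n % t) % t             ≡⟨ %-distribˡ-+ m (n % t) t ⟩
      (m % t + n % t % t) % t     ≡⟨ cong (λ z → (m % t + z) % t) (m%n%n≡m%n n t) ⟩
      (m % t + n % t) % t         ≡⟨ %-distribˡ-+ m n t ⟨
      (m + n) % t                 ∎
      where open ≡-Reasoning

  unresidue-residue : ∀ i j → unresidue i (residue i j) ≡ j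
  unresidue-residue i j = toℕ-injective (begin
    toℕ (unresidue i (residue i j))           ≡⟨ toℕ-fromℕ< _ ⟩
    (i * t′ + toℕ (residue i j)) % t          ≡⟨ cong (λ z → (i * t′ + z) % t) (toℕ-fromℕ< _) ⟩
    (i * t′ + (i + toℕ j) % t) % t            ≡⟨ +-% (i * t′) (i + toℕ j) ⟩
    (i * t′ + (i + toℕ j)) % t                ≡⟨ cong (_% t) (rearrange i t′ (toℕ j)) ⟩
    (toℕ j + i * t) % t                       ≡⟨ [m+kn]%n≡m%n (toℕ j) i t ⟩
    toℕ j % t                                 ≡⟨ m<n⇒m%n≡m (toℕ<n j) ⟩
    toℕ j                                     ∎)
    where
    open ≡-Reasoning
    rearrange : ∀ i t′ j → i * t′ + (i + j) ≡ j + i * suc t′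
    rearrange = solve-∀

  residue-unresidue : ∀ i r → residue i (unresidue i r) ≡ r
  residue-unresidue i r = toℕ-injective (begin
    toℕ (residue i (unresidue i r))           ≡⟨ toℕ-fromℕ< _ ⟩
    (i + toℕ (unresidue i r)) % t             ≡⟨ cong (λ z → (i + z) % t) (toℕ-fromℕ< _) ⟩
    (i + (i * t′ + toℕ r) % t) % t            ≡⟨ +-% i (i * t′ + toℕ r) ⟩
    (i + (i * t′ + toℕ r)) % t                ≡⟨ cong (_% t) (rearrange i t′ (toℕ r)) ⟩
    (toℕ r + i * t) % t                       ≡⟨ [m+kn]%n≡m%n (toℕ r) i t ⟩
    toℕ r % t                                 ≡⟨ m<n⇒m%n≡m (toℕ<n r) ⟩
    toℕ r                                     ∎)
    where
    open ≡-Reasoning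
    rearrange : ∀ i t′ r → i + (i * t′ + r) ≡ r + i * suc t′
    rearrange = solve-∀

  -- The array and its detecting property

  module _ {k v d : ℕ} (1≤k : 1 ≤ k) (d+1≤v : d + 1 ≤ v) (𝓕 : OrthogonalFamily k v) where
    open OrthogonalFamily 𝓕

    private
      K = k + t ∸ 1
      N = (d + 1) * v ^ t

      -- The two sides differ by (k - 1)(t - 1). The bound keeps the quotient of a column number by
      -- `t` below `k`, so that it can index the family.
      K≤k*t : K ≤ k * t
      K≤k*t = bound k 1≤k
        where
        expand : ∀ k t′ → suc k * suc t′ ≡ (k + suc t′) + k * t′
        expand = solve-∀
        bound : ∀ k → 1 ≤ k → k + t ∸ 1 ≤ k * t
        bound (suc k) _ = subst (k + t ≤_) (sym (expand k t′)) (ℕₚ.m≤m+n (k + t) (k * t′))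

    block : Fin K → Fin k
    block c = fromℕ< (m<n*o⇒m/o<n (ℕₚ.<-≤-trans (toℕ<n c) K≤k*t))

    class : Fin K → Fin t
    class c = fromℕ< (m%n<n (toℕ c) t)

    -- Quotient and remainder by `t` determine a column. Thus `orthogonal` applies to any two
    -- columns that use the same coordinate.
    same-class⇒distinct-blocks : ∀ {c c′} → class c ≡ class c′ → c ≢ c′ → block c ≢ block c′
    same-class⇒distinct-blocks {c} {c′} eq c≢c′ eq′ = c≢c′ (toℕ-injective (begin
      toℕ c                              ≡⟨ m≡m%n+[m/n]*n (toℕ c) t ⟩
      toℕ c % t + toℕ c / t * t          ≡⟨ cong₂ (λ r b → r + b * t) (fromℕ<⁻¹ eq) (fromℕ<⁻¹ eq′) ⟩
      toℕ c′ % t + toℕ c′ / t * t        ≡⟨ m≡m%n+[m/n]*n (toℕ c′) t ⟨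
      toℕ c′                             ∎))
      where
      open ≡-Reasoning
      fromℕ<⁻¹ : ∀ {m n o} .{m<o : m < o} .{n<o : n < o} → fromℕ< m<o ≡ fromℕ< n<o → m ≡ n
      fromℕ<⁻¹ {m<o = m<o} {n<o} e = trans (sym (toℕ-fromℕ< m<o)) (trans (cong toℕ e) (toℕ-fromℕ< n<o))

    -- Each column reads only the coordinate of its class. The levels are regarded as symbols by
    -- means of `d+1≤v`.
    entry : (Fin t → Fin v) → Fin (d + 1) → Fin K → Fin v
    entry x y c = F (block c) (x (class c)) (inject≤ y d+1≤v)

    level : Fin N → Fin (d + 1)
    level r = proj₁ (remQuot {d + 1} (v ^ t) r)

    coordinates : Fin N → Fin t → Fin v
    coordinates r = finToFun (proj₂ (remQuot {d + 1} (v ^ t) r))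

    cdaArray : Array N K v
    cdaArray r = entry (coordinates r) (level r)

    class-column : (T : Interaction t K v) → ∀ j → class (column T j) ≡ residue (start T) j
    class-column (interaction i b _) j =
      fromℕ<-cong _ _ (cong (_% t) (toℕ-fromℕ< (ℕₚ.<-≤-trans (ℕₚ.+-monoʳ-< i (toℕ<n j)) b))) _ _

    module _ (T : Interaction t K v) (y : Fin (d + 1)) where
      private
        σ : ∀ j → ∃ λ x → F (block (column T j)) x (inject≤ y d+1≤v) ≡ Vec.lookup (values T) j
        σ j = solve (block (column T j)) (inject≤ y d+1≤v) (Vec.lookup (values T) j)

        -- The columns of a window have distinct classes, so each equation involves its own
        -- coordinate and they are solved separately; `unresidue` finds the column that governs
        -- coordinate `r`.
        solution : Fin t → Fin v
        solution r = proj₁ (σ (unresidue (start T) r))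

      coveringRow : Fin N
      coveringRow = combine y (funToFin solution)

      level-coveringRow : level coveringRow ≡ y
      level-coveringRow = cong proj₁ (remQuot-combine y (funToFin solution))

      coveringRow∈ρ : ρ cdaArray T coveringRow
      coveringRow∈ρ j = begin
        F b (coordinates coveringRow (class c)) (inject≤ (level coveringRow) d+1≤v)
          ≡⟨ cong (λ rq → F b (finToFun (proj₂ rq) (class c)) (inject≤ (proj₁ rq) d+1≤v))
                  (remQuot-combine y (funToFin solution)) ⟩
        F b (finToFun (funToFin solution) (class c)) y′
          ≡⟨ cong (λ z → F b z y′) (finToFun-funToFin solution (class c)) ⟩
        F b (solution (class c)) y′
          ≡⟨ cong (λ r → F b (solution r) y′) (class-column T j) ⟩
        F b (proj₁ (σ (unresidue (start T) (residue (start T) j)))) y′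
          ≡⟨ cong (λ j → F b (proj₁ (σ j)) y′) (unresidue-residue (start T) j) ⟩
        F b (proj₁ (σ j)) y′
          ≡⟨ proj₂ (σ j) ⟩
        Vec.lookup (values T) j ∎
        where
        open ≡-Reasoning
        c = column T j
        b = block c
        y′ = inject≤ y d+1≤v

    -- The last column of the later window lies outside the earlier one, which contains a
    -- column of the same residue class; these two columns determine the level.
    shared-rows-level : (T T′ : Interaction t K v) → start T < start T′ → ∀ {r r′} →
                ρ cdaArray T r → ρ cdaArray T r′ → ρ cdaArray T′ r → ρ cdaArray T′ r′ →
                level r ≡ level r′
    shared-rows-level T@(interaction i _ _) T′@(interaction i′ _ _) i<i′ {r} {r′} Tr Tr′ T′r T′r′ =
      inject≤-injective d+1≤v d+1≤v _ _
        (orthogonal (same-class⇒distinct-blocks {c} {c′} classes (<⇒≢ c<c′))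
          (trans (Tr j) (sym (Tr′ j)))
          (subst (λ z → F (block c′) (coordinates r z) _ ≡ F (block c′) (coordinates r′ z) _)
                 (sym classes) (trans (T′r j′) (sym (T′r′ j′)))))
      where
      j′ = Fin.fromℕ t′
      j  = unresidue i (residue i′ j′)
      c  = column T j
      c′ = column T′ j′
      classes : class c ≡ class c′
      classes = trans (class-column T j) (trans (residue-unresidue i (residue i′ j′)) (sym (class-column T′ j′)))
      c<c′ : c Fin.< c′
      c<c′ = begin-strict
        toℕ c         ≡⟨ toℕ-fromℕ< _ ⟩
        i + toℕ j     ≤⟨ ℕₚ.+-monoʳ-≤ i (ℕₚ.≤-pred (toℕ<n j)) ⟩
        i + t′        <⟨ ℕₚ.+-monoˡ-< t′ i<i′ ⟩
        i′ + t′       ≡⟨ cong (i′ +_) (toℕ-fromℕ t′) ⟨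
        i′ + toℕ j′   ≡⟨ toℕ-fromℕ< _ ⟨
        toℕ c′        ∎
        where open ℕₚ.≤-Reasoning

    -- Different starts would force equal levels by `shared-rows-level`. With equal starts, a single
    -- common row displays both value vectors.
    two-shared-rows⇒≡ : (T T′ : Interaction t K v) → ∀ {r r′} → level r ≢ level r′ →
                        ρ cdaArray T r → ρ cdaArray T r′ → ρ cdaArray T′ r → ρ cdaArray T′ r′ →
                        T ≡ T′
    two-shared-rows⇒≡ T T′ ≢ Tr Tr′ T′r T′r′ with ℕₚ.<-cmp (start T) (start T′)
    ... | tri< i<i′ _ _ = contradiction (shared-rows-level T T′ i<i′ Tr Tr′ T′r T′r′) ≢
    ... | tri> _ _ i>i′ = contradiction (shared-rows-level T′ T i>i′ T′r T′r′ Tr Tr′) ≢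
    two-shared-rows⇒≡ (interaction i _ x) (interaction _ _ x′) _ Tr _ T′r _ | tri≈ _ refl _ =
      cong (interaction i _) (begin
        x                           ≡⟨ tabulate∘lookup x ⟨
        tabulate (Vec.lookup x)     ≡⟨ tabulate-cong (λ j → trans (sym (Tr j)) (T′r j)) ⟩
        tabulate (Vec.lookup x′)    ≡⟨ tabulate∘lookup x′ ⟩
        x′                          ∎)
      where open ≡-Reasoning

    -- Distinct interactions share rows of at most one level, so d of them cannot exhaust the
    -- d + 1 covering rows of another one.
    ρ⊆ρ⋃⇒∈ : (𝒯 : List (Interaction t K v)) → length 𝒯 ≡ d → (T : Interaction t K v) →
              ρ cdaArray T ⊆ ρ⋃ cdaArray 𝒯 → T ∈ 𝒯
    ρ⊆ρ⋃⇒∈ 𝒯 refl T sub = collision⇒∈ (pigeonhole (ℕₚ.m<m+n d ℕ.z<s) (λ y → Any.index (hit y)))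
      where
      hit : ∀ y → ρ⋃ cdaArray 𝒯 (coveringRow T y)
      hit y = sub (coveringRow∈ρ T y)
      levels≢ : ∀ {y y′} → y Fin.< y′ → level (coveringRow T y) ≢ level (coveringRow T y′)
      levels≢ {y} {y′} y<y′ eq =
        <⇒≢ y<y′ (trans (sym (level-coveringRow T y)) (trans eq (level-coveringRow T y′)))
      collision⇒∈ : (∃₂ λ y y′ → y Fin.< y′ × Any.index (hit y) ≡ Any.index (hit y′)) → T ∈ 𝒯
      collision⇒∈ (y , y′ , y<y′ , eq) =
        subst (_∈ 𝒯)
          (sym (two-shared-rows⇒≡ T (List.lookup 𝒯 (Any.index (hit y))) (levels≢ y<y′)
            (coveringRow∈ρ T y) (coveringRow∈ρ T y′) (lookup-index (hit y))
            (subst (λ i → ρ cdaArray (List.lookup 𝒯 i) _) (sym eq) (lookup-index (hit y′)))))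
          (∈-lookup _)

    cda : CDA d t N K v
    cda = record
      { array     = cdaArray
      ; covering  = λ T → coveringRow T first , coveringRow∈ρ T first
      ; detecting = λ 𝒯 _ len T → mk⇔ (ρ⊆ρ⋃⇒∈ 𝒯 len T) (λ T∈𝒯 Tr → lose T∈𝒯 Tr)
      }
      where
      first : Fin (d + 1)
      first = fromℕ< (ℕₚ.m<m+n d ℕ.z<s)

mainTheorem10 : (v : ℕ) → 2 ≤ v →
    (F : PrimePowerFactorization v) →
    (k : ℕ) → IsMinimumOf k (PrimePowerFactorization.q F) →
    (t d : ℕ) → 1 ≤ t → 1 ≤ d →
    (∀ i → t + 1 < PrimePowerFactorization.q F i) →
    d + 1 ≤ v →
    Σ (CDA d t ((d + 1) * v ^ t) (k + t ∸ 1) v) Optimum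
mainTheorem10 v _ F k ((i₀ , qi₀≡k) , k≤q) (suc t) d _ _ _ d+1≤v = cda t 1≤k d+1≤v family , refl
  where
  open PrimePowerFactorization F
  1≤k : 1 ≤ k
  1≤k = subst (1 ≤_) qi₀≡k (ℕₚ.<⇒≤ (2≤p^e (base-prime i₀) (exponent-pos i₀)))
  family : OrthogonalFamily k v
  -- The factor `q i` supplies a family of `q i` maps, while the product needs the same number for
  -- every factor; each family is cut down to the minimum `k`.
  family = subst (OrthogonalFamily k) product-q
    (foldr-productFamily q (λ i → restrict (k≤q i) (primePowerFamily (base-prime i) (exponent-pos i))))
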